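{- Let $\mathcal{F}$ be a finite family of connected graphs. Then there is a constant $C_\mathcal{F}$ such that every connected $\mathcal{F}$-free graph $G$ (of order at least $3$) satisfies $rx_3(G)\leq sdiam_3(G)+C_\mathcal{F}$ if and only if $\mathcal{F}$ contains a subfamily $\mathcal{F}'$ of one of the following forms: (1) $\mathcal{F}'=\{P_3\}$; (2) $\mathcal{F}'=\{K_{1,r},P_4\}$ for some $r\geq 3$; (3) $\mathcal{F}'=\{K_{1,r},Y,P_\ell\}$ for some $r\geq 3$, $\ell>4$, and some graph $Y$ that is an induced subgraph of $K_s^h$ for some $s\geq 3$.
   Context: All graphs are finite, simple, undirected. A tree in an edge-colored graph is rainbow if no two of its edges have the same color; an $S$-tree is a tree containing all vertices of $S$. A $3$-rainbow coloring of a connected graph $G$ is an edge-coloring (adjacent edges may share colors) such that every $3$-element vertex set $S$ has a rainbow $S$-tree; $rx_3(G)$ is the minimum number of colors in such a coloring. $sdiam_3(G)$ is the maximum, over all $3$-element $S\subseteq V(G)$, of the minimum number of edges of an $S$-tree. $G$ is $\mathcal{F}$-free if it has no induced subgraph isomorphic to a member of $\mathcal{F}$. $P_n$ is the path on $n$ vertices, $K_{1,r}$ the star with $r$ leaves, $K_s^h$ the graph obtained from $K_s$ by attaching a pendant edge to each vertex.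
   Formalization: The "only if" direction additionally assumes every member of the family has order at least 3, since for {K_1} or {K_2} no connected F-free graph of order at least 3 exists and the claim fails; the "if" direction is proved for all finite families of connected graphs. -}

module Defs where

open import Data.Empty using (⊥)
open import Data.Fin using (Fin; zero; suc; toℕ; fromℕ; inject₁; splitAt; _<?_)
open import Data.Fin.Properties using () renaming (_≟_ to _≟ᶠ_)
open import Data.Fin.Subset using (Subset; _∈_; ∣_∣)
open import Data.List using (List; []; _∷_; length; filter; allFin; cartesianProduct)
open import Data.List.Relation.Unary.All using (All)
open import Data.List.Relation.Unary.Any using (Any)
open import Data.Nat using (ℕ; suc; _+_; _≤_; _<_; _≥_; _>_)
open import Data.Nat.Properties using (1+n≢n) renaming (_≟_ to _≟ⁿ_)
open import Data.Product using (Σ; ∃-syntax; _×_; _,_)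
open import Data.Sum using (_⊎_; inj₁; inj₂; swap)
open import Data.Unit using (⊤; tt)
open import Function using (_∘_; _on_)
open import Function.Bundles using (_⇔_; _↔_; Inverse)
open import Function.Definitions using (Injective)
open import Level using (0ℓ)
open import Relation.Binary.Core using (Rel)
open import Relation.Binary.Definitions using (Decidable; Symmetric; Irreflexive)
open import Relation.Binary.Construct.Closure.ReflexiveTransitive using (Star)
open import Relation.Binary.PropositionalEquality using (_≡_; _≢_; refl; sym)
open import Relation.Nullary using (¬_; yes; no; ¬?; _×-dec_; _⊎-dec_)

record Graph : Set₁ where
  field
    order  : ℕ
    Adj    : Rel (Fin order) 0ℓ
    adj?   : Decidable Adj
    symm   : Symmetric Adj
    irrefl : Irreflexive _≡_ Adj

  Vertex : Set
  Vertex = Fin order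

  -- Each edge is counted once, as the pair of its endpoints in increasing order.
  size : ℕ
  size = length (filter (λ (u , v) → (u <? v) ×-dec adj? u v)
                        (cartesianProduct (allFin order) (allFin order)))

  -- The graph without vertices is not connected.
  Connected : Set
  Connected = (0 < order) × (∀ u v → Star Adj u v)

  record Cycle : Set where
    field
      m         : ℕ
      vertex    : Fin (3 + m) → Vertex
      injective : Injective _≡_ _≡_ vertex
      step      : ∀ (i : Fin (2 + m)) → Adj (vertex (inject₁ i)) (vertex (suc i))
      close     : Adj (vertex (fromℕ (2 + m))) (vertex zero)

  IsTree : Set
  IsTree = Connected × (¬ Cycle)

open Graph public using (order; Adj; Vertex; size; Connected; IsTree)

infix 4 _≅_ _⊴_ _⊑_

record _≅_ (G H : Graph) : Set where
  field
    bijection : Vertex G ↔ Vertex H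
    adjacency : ∀ u v → Adj G u v ⇔ Adj H (Inverse.to bijection u) (Inverse.to bijection v)

-- H ⊴ G : H is isomorphic to an induced subgraph of G.
record _⊴_ (H G : Graph) : Set where
  field
    embed     : Vertex H → Vertex G
    injective : Injective _≡_ _≡_ embed
    adjacency : ∀ u v → Adj H u v ⇔ Adj G (embed u) (embed v)

Free : List Graph → Graph → Set₁
Free 𝓕 G = All (λ H → ¬ (H ⊴ G)) 𝓕

-- Families are taken up to isomorphism of their members.
_⊑_ : List Graph → List Graph → Set₁
𝓕′ ⊑ 𝓕 = All (λ H → Any (H ≅_) 𝓕) 𝓕′

-- A subgraph of G that is a tree and contains S, presented as an abstract tree
-- together with an injective, not necessarily induced, homomorphism into G.
record STree (G : Graph) (S : Subset (order G)) : Set₁ where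
  field
    tree      : Graph
    isTree    : IsTree tree
    embed     : Vertex tree → Vertex G
    injective : Injective _≡_ _≡_ embed
    preserves : ∀ {u v} → Adj tree u v → Adj G (embed u) (embed v)
    covers    : ∀ {v} → v ∈ S → ∃[ t ] embed t ≡ v

-- Only the values on adjacent pairs matter; values on other pairs are junk.
record EdgeColoring (G : Graph) (k : ℕ) : Set where
  field
    color : Vertex G → Vertex G → Fin k
    symm  : ∀ u v → color u v ≡ color v u

Rainbow : ∀ {G k S} → EdgeColoring G k → STree G S → Set
Rainbow c t = ∀ {u v x y} → Adj tree u v → Adj tree x y →
  color (embed u) (embed v) ≡ color (embed x) (embed y) →
  (u ≡ x × v ≡ y) ⊎ (u ≡ y × v ≡ x)
  where
  open EdgeColoring c
  open STree t

Is3Rainbow : ∀ {G k} → EdgeColoring G k → Set₁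
Is3Rainbow {G} c = ∀ (S : Subset (order G)) → ∣ S ∣ ≡ 3 → Σ (STree G S) (Rainbow c)

IsMinimum : ∀ {ℓ} → (ℕ → Set ℓ) → ℕ → Set ℓ
IsMinimum P m = P m × (∀ k → P k → m ≤ k)

IsMaximum : ∀ {ℓ} → (ℕ → Set ℓ) → ℕ → Set ℓ
IsMaximum P m = P m × (∀ k → P k → k ≤ m)

-- Rx₃ G k : the minimum defining rx₃(G) is attained at k.
Rx₃ : Graph → ℕ → Set₁
Rx₃ G = IsMinimum (λ k → Σ (EdgeColoring G k) Is3Rainbow)

SteinerDistance : (G : Graph) → Subset (order G) → ℕ → Set₁
SteinerDistance G S = IsMinimum (λ m → Σ (STree G S) λ t → size (STree.tree t) ≡ m)

-- Sdiam₃ G d : the maximum defining sdiam₃(G) is attained at d.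
Sdiam₃ : Graph → ℕ → Set₁
Sdiam₃ G = IsMaximum (λ d → Σ (Subset (order G)) λ S → ∣ S ∣ ≡ 3 × SteinerDistance G S d)

path : ℕ → Graph
path n = record
  { order  = n
  ; Adj    = λ u v → suc (toℕ u) ≡ toℕ v ⊎ suc (toℕ v) ≡ toℕ u
  ; adj?   = λ u v → (suc (toℕ u) ≟ⁿ toℕ v) ⊎-dec (suc (toℕ v) ≟ⁿ toℕ u)
  ; symm   = swap
  ; irrefl = λ { refl (inj₁ p) → 1+n≢n p ; refl (inj₂ p) → 1+n≢n p }
  }

StarAdj : ∀ {r} → Rel (Fin (suc r)) 0ℓ
StarAdj zero    zero    = ⊥
StarAdj zero    (suc _) = ⊤
StarAdj (suc _) zero    = ⊤
StarAdj (suc _) (suc _) = ⊥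

-- K_{1,r}, with centre zero.
star : ℕ → Graph
star r = record
  { order  = suc r
  ; Adj    = StarAdj
  ; adj?   = dec
  ; symm   = λ {u} {v} → symm u v
  ; irrefl = λ { {u} refl → irrefl u }
  }
  where
  dec : Decidable (StarAdj {r})
  dec zero    zero    = no λ ()
  dec zero    (suc _) = yes tt
  dec (suc _) zero    = yes tt
  dec (suc _) (suc _) = no λ ()

  symm : ∀ (u v : Fin (suc r)) → StarAdj u v → StarAdj v u
  symm zero    (suc _) _ = tt
  symm (suc _) zero    _ = tt

  irrefl : ∀ (u : Fin (suc r)) → ¬ StarAdj u u
  irrefl zero    ()
  irrefl (suc _) ()

-- inj₁ i is a vertex of the clique and inj₂ i the pendant vertex attached to it.
HairAdj : ∀ {s} → Rel (Fin s ⊎ Fin s) 0ℓ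
HairAdj (inj₁ i) (inj₁ j) = i ≢ j
HairAdj (inj₁ i) (inj₂ j) = i ≡ j
HairAdj (inj₂ i) (inj₁ j) = i ≡ j
HairAdj (inj₂ _) (inj₂ _) = ⊥

-- K_s^h.
hairyClique : ℕ → Graph
hairyClique s = record
  { order  = s + s
  ; Adj    = HairAdj on splitAt s
  ; adj?   = λ u v → dec (splitAt s u) (splitAt s v)
  ; symm   = λ {u} {v} → symm (splitAt s u) (splitAt s v)
  ; irrefl = λ { {u} refl → irrefl (splitAt s u) }
  }
  where
  dec : Decidable (HairAdj {s})
  dec (inj₁ i) (inj₁ j) = ¬? (i ≟ᶠ j)
  dec (inj₁ i) (inj₂ j) = i ≟ᶠ j
  dec (inj₂ i) (inj₁ j) = i ≟ᶠ j
  dec (inj₂ _) (inj₂ _) = no λ ()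

  symm : ∀ (u v : Fin s ⊎ Fin s) → HairAdj u v → HairAdj v u
  symm (inj₁ _) (inj₁ _) p = p ∘ sym
  symm (inj₁ _) (inj₂ _) p = sym p
  symm (inj₂ _) (inj₁ _) p = sym p

  irrefl : ∀ (u : Fin s ⊎ Fin s) → ¬ HairAdj u u
  irrefl (inj₁ _) p = p refl

data Form : List Graph → Set₁ where
  form₁ : Form (path 3 ∷ [])
  form₂ : ∀ {r} → r ≥ 3 → Form (star r ∷ path 4 ∷ [])
  form₃ : ∀ {r ℓ Y} → r ≥ 3 → ℓ > 4 → (∃[ s ] s ≥ 3 × Y ⊴ hairyClique s) →
          Form (star r ∷ Y ∷ path ℓ ∷ [])

ContainsForm : List Graph → Set₁
ContainsForm 𝓕 = Σ (List Graph) λ 𝓕′ → 𝓕′ ⊑ 𝓕 × Form 𝓕′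

Rx₃≤Sdiam₃+Const : List Graph → Set₁
Rx₃≤Sdiam₃+Const 𝓕 = ∃[ C ] ∀ (G : Graph) → Connected G → order G ≥ 3 → Free 𝓕 G →
  ∀ {r d} → Rx₃ G r → Sdiam₃ G d → r ≤ d + C

{-# OPTIONS --safe #-}
module Submission where

-- Sufficiency: each form excludes some K_{1,r}, K_s^h and P_ℓ, and these bound
-- rx₃ by a constant.  Start from one vertex and repeatedly enlarge a connected
-- set D: a maximal independent set I at distance two from D reaches D through
-- neighbours m x (x ∈ I), and Ramsey's theorem bounds |I|, as a large I would
-- give a K_{1,r} or a K_s^h.  Adding I and the m x makes D dominate one more
-- layer, and there are fewer than ℓ layers since geodesics are induced paths.
-- Two further maximal independent sets outside the dominating set, again of
-- bounded size, give a bounded connected set in which every other vertex has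
-- three neighbours.  Colour a spanning tree of it injectively and use
-- three more colours for the three kinds of edges towards it.
--
-- Necessity: stars and hairy cliques have bounded sdiam₃ but many pendant
-- edges, which need distinct colours; the cycle C_n has sdiam₃ about 2n/3 but
-- needs n − 2 colours.  So 𝓕 must contain an induced subgraph of each of them.
-- The values rx₃ and sdiam₃ are only shown to exist up to double negation,
-- which is enough because H ⊴ G is decidable.

open import Data.Empty using (⊥; ⊥-elim)
open import Data.Fin using (Fin; zero; suc; toℕ; fromℕ; fromℕ<; #_; inject₁; inject≤; join; punchIn; punchOut; splitAt; _↑ʳ_; _↑ˡ_)
import Data.Fin as Fin
open import Data.Fin.Properties using (all?; any?; inject≤-injective; injective⇒≤; join-splitAt; pigeonhole; punchIn-injective; punchIn-mono-≤; punchInᵢ≢i; punchOut-injective; splitAt-join; splitAt-↑ʳ; splitAt-↑ˡ; toℕ-fromℕ<; toℕ-injective; toℕ-inject₁; toℕ<n; ↑ʳ-injective) renaming (_≟_ to _≟ᶠ_; <-cmp to <-cmpᶠ; <⇒≢ to <⇒≢ᶠ; suc-injective to suc-injectiveᶠ)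
open import Data.Fin.Relation.Unary.Top using (view; ‵fromℕ; ‵inject₁)
open import Data.Fin.Subset using (Subset; inside; outside; ∣_∣) renaming (_∈_ to _∈ˢ_; ⊥ to ∅)
open import Data.Fin.Subset.Properties using (∣⊥∣≡0; ∉⊥)
open import Data.List using (List; []; _∷_; allFin; cartesianProduct; filter; length; lookup; map)
open import Data.List.Membership.Propositional using (_∈_; _∉_; find; lose)
open import Data.List.Membership.Propositional.Properties using (∈-allFin; ∈-lookup; ∈-map⁺)
open import Data.List.Properties using (length-map)
open import Data.List.Relation.Binary.Subset.Propositional using (_⊆_)
open import Data.List.Relation.Unary.All as All using (All; []; _∷_)
import Data.List.Relation.Unary.All.Properties as All
open import Data.List.Relation.Unary.AllPairs as AllPairs using (AllPairs; []; _∷_)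
import Data.List.Relation.Unary.AllPairs.Properties as AllPairs
open import Data.List.Relation.Unary.Any as Any using (Any; here; there; index)
open import Data.List.Relation.Unary.Any.Properties using (lookup-index)
open import Data.List.Relation.Unary.Unique.Propositional using (Unique)
import Data.List.Relation.Unary.Unique.Propositional.Properties as Unique
open import Data.Nat using (ℕ; zero; suc; _+_; _*_; _∸_; _⊔_; _≤_; _<_; _≥_; z≤n; s≤s; s≤s⁻¹; _≤?_; _<?_)
open import Data.Nat.Induction using (<-rec)
open import Data.Nat.ListAction using (sum)
open import Data.Nat.Properties
open import Data.Nat.Tactic.RingSolver using (solve-∀)
open import Data.Product using (Σ; ∃; ∃₂; ∃-syntax; _×_; _,_; proj₁; proj₂)
open import Data.Sum using (_⊎_; inj₁; inj₂; swap)
open import Data.Unit using (tt)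
open import Data.Vec using (Vec; []; _∷_)
import Data.Vec as Vec
open import Data.Vec.Properties using (lookup∘tabulate)
open import Function using (_∘_; id)
open import Function.Bundles using (_⇔_; mk⇔; mk↔ₛ′; Equivalence; Inverse)
open import Function.Definitions using (Injective)
open import Level using (0ℓ)
open import Relation.Binary.Construct.Closure.ReflexiveTransitive using (Star; ε; _◅_; _◅◅_; gmap; reverse)
open import Relation.Binary.Core using (Rel)
open import Relation.Binary.Definitions using (Decidable; tri<; tri≈; tri>)
open import Relation.Binary.PropositionalEquality using (_≡_; _≢_; refl; sym; trans; cong; cong₂; subst; subst₂; module ≡-Reasoning)
open import Relation.Nullary using (¬_; Dec; yes; no; ¬?; _×-dec_; _⊎-dec_; _→-dec_)
open import Relation.Nullary.Decidable using (map′; toWitness)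
import Relation.Unary as U
open import Defs

-- The three neighbours per outside vertex are what a triple needs: the vertices of S may all have
-- the same neighbours, so each is attached by its own kind of edge. The obstruction behind the
-- cycle bound is that a rainbow tree through three vertices leaves out edges of only one of the
-- three arcs between them, while of two equally coloured edges one must be left out. Suitable
-- triples exclude three edges of one colour, two disjoint or nested colour pairs, and three
-- mutually interleaved ones, so at most two edges repeat an earlier colour. A connected induced
-- subgraph of a star is a star, and a proper one of a cycle is a path, so two of the members found
-- in the family are known up to their size; the third remains an arbitrary induced subgraph Y of a
-- hairy clique. Small sizes collapse the list: K_{1,2} is P_3, and P_4 already lies in every K_s^h
-- with s at least 3, so form (2) needs no Y.

least : ∀ {n} (f : Fin (suc n) → ℕ) → ∃[ i ] ∀ j → f i ≤ f j
least {zero}  f = zero , λ { zero → ≤-refl }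
least {suc n} f with least (f ∘ suc)
... | i , min with f zero ≤? f (suc i)
...   | yes p = zero , λ { zero → ≤-refl ; (suc j) → ≤-trans p (min j) }
...   | no ¬p = suc i , λ { zero → ≰⇒≥ ¬p ; (suc j) → min j }

lookup-symmetric : ∀ {A : Set} {R : Rel A 0ℓ} → (∀ {x y} → R x y → R y x) →
                   ∀ {xs} → AllPairs R xs → ∀ {i j} → i ≢ j → R (lookup xs i) (lookup xs j)
lookup-symmetric s (r ∷ rs) {zero}  {zero}  i≢j = ⊥-elim (i≢j refl)
lookup-symmetric s (r ∷ rs) {zero}  {suc j} _   = All.lookup r (∈-lookup j)
lookup-symmetric s (r ∷ rs) {suc i} {zero}  _   = s (All.lookup r (∈-lookup i))
lookup-symmetric s (r ∷ rs) {suc i} {suc j} i≢j = lookup-symmetric s rs (i≢j ∘ cong suc)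

lookup-injective : ∀ {A : Set} {xs : List A} → Unique xs → Injective _≡_ _≡_ (lookup xs)
lookup-injective u {i} {j} eq with i ≟ᶠ j
... | yes i≡j = i≡j
... | no  i≢j = ⊥-elim (lookup-symmetric (λ ≢ → ≢ ∘ sym) u i≢j eq)

unique⇒length≤ : ∀ {n} {xs : List (Fin n)} → Unique xs → length xs ≤ n
unique⇒length≤ u = injective⇒≤ (lookup-injective u)

allPairs-mapWith : ∀ {A : Set} {P : A → Set} {R Q : Rel A 0ℓ} →
                   (∀ {x y} → P x → P y → R x y → Q x y) →
                   ∀ {xs} → All P xs → AllPairs R xs → AllPairs Q xs
allPairs-mapWith f []         []         = []
allPairs-mapWith f (px ∷ pxs) (rx ∷ rxs) =
  All.zipWith (λ (py , r) → f px py r) (pxs , rx) ∷ allPairs-mapWith f pxs rxs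

-- Trees built by attaching leaves

cycle-neighbours : ∀ {G} (c : Graph.Cycle G) → let open Graph.Cycle c in
  ∀ i → ∃₂ λ j k → j ≢ k × Adj G (vertex i) (vertex j) × Adj G (vertex i) (vertex k)
cycle-neighbours {G} c zero =
  suc zero , fromℕ _ , (λ ()) , step zero , Graph.symm G close
  where open Graph.Cycle c
cycle-neighbours {G} c (suc i) with view i
... | ‵fromℕ = inject₁ (fromℕ _) , zero , (λ ()) , Graph.symm G (step _) , close
  where open Graph.Cycle c
... | ‵inject₁ i′ = inject₁ (inject₁ i′) , suc (suc i′) , i≢ , Graph.symm G (step _) , step (suc i′)
  where
  open Graph.Cycle c
  i≢ : inject₁ (inject₁ i′) ≢ suc (suc i′)
  i≢ eq = <⇒≢ (s≤s (n≤1+n _))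
    (trans (sym (trans (toℕ-inject₁ _) (toℕ-inject₁ i′))) (cong toℕ eq))

-- If every vertex has at most one neighbour above it, the lowest vertex of a
-- cycle would have two.
module _ (T : Graph) (up : ∀ {u v w} → u Fin.< v → u Fin.< w → Adj T u v → Adj T u w → v ≡ w) where

  acyclic : ¬ Graph.Cycle T
  acyclic c with least (toℕ ∘ Graph.Cycle.vertex c)
  ... | i , min with cycle-neighbours c i
  ... | j , k , j≢k , ij , ik = j≢k (injective (up (above ij) (above ik) ij ik))
    where
    open Graph.Cycle c
    above : ∀ {j} → Adj T (vertex i) (vertex j) → vertex i Fin.< vertex j
    above {j} e = ≤∧≢⇒< (min j) λ eq → Graph.irrefl T (toℕ-injective eq) e

  -- Charging each edge to its lower endpoint is injective. For trees this is one more than the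
  -- exact count, which only shifts later constants.
  size≤order : size T ≤ order T
  size≤order = subst (_≤ order T) (length-map proj₁ edges) (unique⇒length≤ (AllPairs.map⁺ distinct))
    where
    edges : List (Vertex T × Vertex T)
    edges = filter (λ (u , v) → (u Fin.<? v) ×-dec Graph.adj? T u v)
                   (cartesianProduct (allFin (order T)) (allFin (order T)))
    distinct : AllPairs (λ e f → proj₁ e ≢ proj₁ f) edges
    distinct = allPairs-mapWith
      {P = λ (u , v) → u Fin.< v × Adj T u v}
      (λ { (u<v , uv) (u<w , uw) e≢f refl → e≢f (cong (_ ,_) (up u<v u<w uv uw)) })
      (All.all-filter _ (cartesianProduct (allFin (order T)) (allFin (order T))))
      (Unique.filter⁺ _ (Unique.cartesianProduct⁺ (Unique.allFin⁺ _) (Unique.allFin⁺ _)))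

module _ {G : Graph} where

  private
    V : Set
    V = Vertex G

  -- The vertex list of a tree of G, the latest attached leaf first.
  data Grown : List V → Set where
    root   : ∀ v → Grown (v ∷ [])
    attach : ∀ {L} x {p} → Grown L → x ∉ L → p ∈ L → Adj G x p → Grown (x ∷ L)

  -- Tree vertices are positions in the list, so a parent has a larger index than its child; the
  -- membership proof `p∈L` doubles as the pointer to the parent.
  TreeAdj : ∀ {L} → Grown L → Rel (Fin (length L)) 0ℓ
  TreeAdj (root _)             _       _       = ⊥
  TreeAdj (attach _ _ _ _ _)   zero    zero    = ⊥
  TreeAdj (attach _ _ _ p∈L _) zero    (suc v) = v ≡ index p∈L
  TreeAdj (attach _ _ _ p∈L _) (suc u) zero    = u ≡ index p∈L
  TreeAdj (attach _ g _ _ _)   (suc u) (suc v) = TreeAdj g u v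

  grownTree : ∀ {L} → Grown L → Graph
  grownTree {L} g = record
    { order  = length L
    ; Adj    = TreeAdj g
    ; adj?   = dec g
    ; symm   = λ {u} {v} → symm g u v
    ; irrefl = λ { {u} refl → irrefl g u }
    }
    where
    dec : ∀ {L} (g : Grown L) → Decidable (TreeAdj g)
    dec (root _)             _       _       = no λ ()
    dec (attach _ _ _ _ _)   zero    zero    = no λ ()
    dec (attach _ _ _ p∈L _) zero    (suc v) = v ≟ᶠ index p∈L
    dec (attach _ _ _ p∈L _) (suc u) zero    = u ≟ᶠ index p∈L
    dec (attach _ g _ _ _)   (suc u) (suc v) = dec g u v

    symm : ∀ {L} (g : Grown L) u v → TreeAdj g u v → TreeAdj g v u
    symm (attach _ _ _ _ _) zero    (suc v) e = e
    symm (attach _ _ _ _ _) (suc u) zero    e = e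
    symm (attach _ g _ _ _) (suc u) (suc v) e = symm g u v e

    irrefl : ∀ {L} (g : Grown L) u → ¬ TreeAdj g u u
    irrefl (attach _ g _ _ _) (suc u) e = irrefl g u e

  up-unique : ∀ {L} (g : Grown L) {u v w} → u Fin.< v → u Fin.< w →
              TreeAdj g u v → TreeAdj g u w → v ≡ w
  up-unique (attach _ _ _ _ _) {zero}  {suc _} {suc _} _ _ refl refl = refl
  up-unique (attach _ g _ _ _) {suc _} {suc _} {suc _} (s≤s p) (s≤s q) e f =
    cong suc (up-unique g p q e f)

  connected : ∀ {L} (g : Grown L) u v → Star (TreeAdj g) u v
  connected (root _)             zero    zero    = ε
  connected (attach _ _ _ _ _)   zero    zero    = ε
  connected (attach _ g _ p∈L _) zero    (suc v) = refl ◅ gmap suc id (connected g (index p∈L) v)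
  connected (attach _ g _ p∈L _) (suc u) zero    = gmap suc id (connected g u (index p∈L)) ◅◅ refl ◅ ε
  connected (attach _ g _ _ _)   (suc u) (suc v) = gmap suc id (connected g u v)

  grown-nonempty : ∀ {L} → Grown L → 0 < length L
  grown-nonempty (root _)           = s≤s z≤n
  grown-nonempty (attach _ _ _ _ _) = s≤s z≤n

  grown-unique : ∀ {L} → Grown L → Unique L
  grown-unique (root _)             = [] ∷ []
  grown-unique (attach x g x∉L _ _) = All.¬Any⇒All¬ _ x∉L ∷ grown-unique g

  tree-preserves : ∀ {L} (g : Grown L) u v → TreeAdj g u v → Adj G (lookup L u) (lookup L v)
  tree-preserves (attach _ _ _ p∈L xp) zero    (suc v) refl =
    subst (Adj G _) (lookup-index p∈L) xp
  tree-preserves (attach _ _ _ p∈L xp) (suc u) zero    refl =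
    Graph.symm G (subst (Adj G _) (lookup-index p∈L) xp)
  tree-preserves (attach _ g _ _ _)    (suc u) (suc v) e    = tree-preserves g u v e

  stree : ∀ {L S} → Grown L → (∀ {v} → v ∈ˢ S → v ∈ L) → STree G S
  stree {L} g S⊆L = record
    { tree      = grownTree g
    ; isTree    = (grown-nonempty g , connected g) , acyclic (grownTree g) (up-unique g)
    ; embed     = lookup L
    ; injective = lookup-injective (grown-unique g)
    ; preserves = λ {u} {v} → tree-preserves g u v
    ; covers    = λ v∈S → index (S⊆L v∈S) , sym (lookup-index (S⊆L v∈S))
    }

  tree-size≤ : ∀ {L} (g : Grown L) → size (grownTree g) ≤ length L
  tree-size≤ g = size≤order (grownTree g) (up-unique g)

  module _ (c : V → V → ℕ) where

    edgeColors : ∀ {L} → Grown L → List ℕ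
    edgeColors (root _)               = []
    edgeColors (attach x {p} g _ _ _) = c x p ∷ edgeColors g

    module _ (c-symm : ∀ u v → c u v ≡ c v u) where

      edgeColor∈ : ∀ {L} (g : Grown L) u v → TreeAdj g u v → c (lookup L u) (lookup L v) ∈ edgeColors g
      edgeColor∈ (attach x _ _ p∈L _) zero    (suc v) refl = here (cong (c x) (sym (lookup-index p∈L)))
      edgeColor∈ (attach x _ _ p∈L _) (suc u) zero    refl =
        here (trans (c-symm _ _) (cong (c x) (sym (lookup-index p∈L))))
      edgeColor∈ (attach _ g _ _ _)   (suc u) (suc v) e    = there (edgeColor∈ g u v e)

      -- Each edge is created by exactly one attachment, so equal colours on different edges would
      -- repeat an entry of `edgeColors`. The two outcomes are the two orientations of one edge.
      tree-rainbow : ∀ {L} (g : Grown L) → Unique (edgeColors g) → ∀ u v x y → TreeAdj g u v → TreeAdj g x y →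
                     c (lookup L u) (lookup L v) ≡ c (lookup L x) (lookup L y) →
                     (u ≡ x × v ≡ y) ⊎ (u ≡ y × v ≡ x)
      tree-rainbow (attach _ _ _ _ _) _ zero    (suc _) zero    (suc _) refl refl _ = inj₁ (refl , refl)
      tree-rainbow (attach _ _ _ _ _) _ zero    (suc _) (suc _) zero    refl refl _ = inj₂ (refl , refl)
      tree-rainbow (attach _ _ _ _ _) _ (suc _) zero    zero    (suc _) refl refl _ = inj₂ (refl , refl)
      tree-rainbow (attach _ _ _ _ _) _ (suc _) zero    (suc _) zero    refl refl _ = inj₁ (refl , refl)
      tree-rainbow (attach z g _ p∈L _) (z∉ ∷ _) zero (suc v) (suc x) (suc y) refl e eq =
        ⊥-elim (All.All¬⇒¬Any z∉ (subst (_∈ edgeColors g)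
          (trans (sym eq) (cong (c z) (sym (lookup-index p∈L)))) (edgeColor∈ g x y e)))
      tree-rainbow (attach z g _ p∈L _) (z∉ ∷ _) (suc u) zero (suc x) (suc y) refl e eq =
        ⊥-elim (All.All¬⇒¬Any z∉ (subst (_∈ edgeColors g)
          (trans (sym eq) (trans (c-symm _ _) (cong (c z) (sym (lookup-index p∈L))))) (edgeColor∈ g x y e)))
      tree-rainbow (attach z g _ p∈L _) (z∉ ∷ _) (suc u) (suc v) zero (suc y) e refl eq =
        ⊥-elim (All.All¬⇒¬Any z∉ (subst (_∈ edgeColors g)
          (trans eq (cong (c z) (sym (lookup-index p∈L)))) (edgeColor∈ g u v e)))
      tree-rainbow (attach z g _ p∈L _) (z∉ ∷ _) (suc u) (suc v) (suc x) zero e refl eq =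
        ⊥-elim (All.All¬⇒¬Any z∉ (subst (_∈ edgeColors g)
          (trans eq (trans (c-symm _ _) (cong (c z) (sym (lookup-index p∈L))))) (edgeColor∈ g u v e)))
      tree-rainbow (attach _ g _ _ _) (_ ∷ uniq) (suc u) (suc v) (suc x) (suc y) e f eq
        with tree-rainbow g uniq u v x y e f eq
      ... | inj₁ (refl , refl) = inj₁ (refl , refl)
      ... | inj₂ (refl , refl) = inj₂ (refl , refl)

-- Three-element sets and trees grown along walks

elements : ∀ {n} (S : Subset n) → ∃[ xs ] length xs ≡ ∣ S ∣ × AllPairs Fin._<_ xs × (∀ {v} → v ∈ˢ S → v ∈ xs)
elements [] = [] , refl , [] , λ ()
elements (s ∷ S) with elements S
elements (outside ∷ S) | xs , len , sorted , cover =
  map suc xs , trans (length-map suc xs) len , AllPairs.map⁺ (AllPairs.map s≤s sorted) ,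
  λ { (Vec.there v∈S) → ∈-map⁺ suc (cover v∈S) }
elements (inside ∷ S) | xs , len , sorted , cover =
  zero ∷ map suc xs , cong suc (trans (length-map suc xs) len) ,
  All.map⁺ (All.universal (λ _ → s≤s z≤n) xs) ∷ AllPairs.map⁺ (AllPairs.map s≤s sorted) ,
  λ { Vec.here → here refl ; (Vec.there v∈S) → there (∈-map⁺ suc (cover v∈S)) }

threeElements : ∀ {n} (S : Subset n) → ∣ S ∣ ≡ 3 →
  ∃[ a ] ∃[ b ] ∃[ c ] a Fin.< b × b Fin.< c × (∀ {v} → v ∈ˢ S → v ∈ a ∷ b ∷ c ∷ [])
threeElements S ∣S∣≡3 with elements S
... | xs , len , sorted , cover with xs | trans len ∣S∣≡3 | sorted
... | a ∷ b ∷ c ∷ [] | refl | (a<b ∷ _) ∷ (b<c ∷ _) ∷ _ = a , b , c , a<b , b<c , cover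

walkLength : ∀ {A : Set} {R : A → A → Set} {u v} → Star R u v → ℕ
walkLength ε       = 0
walkLength (_ ◅ w) = suc (walkLength w)

module _ {G : Graph} where

  private
    V : Set
    V = Vertex G

  open import Data.List.Membership.DecPropositional (_≟ᶠ_ {order G}) using (_∈?_)

  record Extension (L : List V) (x : V) (n : ℕ) : Set where
    constructor extension
    field
      {list}   : List V
      grown    : Grown {G} list
      includes : L ⊆ list
      new      : x ∈ list
      bound    : length list ≤ n + length L

  extend : ∀ {L x p} → Grown {G} L → p ∈ L → Adj G x p → Extension L x 1
  extend {L} {x} g p∈L xp with x ∈? L
  ... | yes x∈L = extension g id x∈L (n≤1+n _)
  ... | no  x∉L = extension (attach x g x∉L p∈L xp) there (here refl) ≤-refl

  -- Vertices already listed are skipped, so the walk may revisit the tree and no path has to be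
  -- extracted from it.
  extendWalk : ∀ {L u v} → Grown {G} L → u ∈ L → (w : Star (Adj G) u v) → Extension L v (walkLength w)
  extendWalk g u∈L ε = extension g id u∈L ≤-refl
  extendWalk {L} g u∈L (e ◅ w) with extend g u∈L (Graph.symm G e)
  ... | extension {L′} g′ L⊆ x∈ len with extendWalk g′ x∈ w
  ... | extension g″ L′⊆ v∈ len′ = extension g″ (L′⊆ ∘ L⊆) v∈
    (≤-trans len′ (≤-trans (+-monoʳ-≤ (walkLength w) len) (≤-reflexive (+-suc _ (length L)))))

  extendList : ∀ {L} xs → Grown {G} L → All (λ x → ∃[ p ] p ∈ L × Adj G x p) xs →
    ∃[ L′ ] Grown {G} L′ × L ⊆ L′ × All (_∈ L′) xs × length L′ ≤ length xs + length L
  extendList []       g []                    = _ , g , id , [] , ≤-refl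
  extendList {L} (x ∷ xs) g ((p , p∈L , xp) ∷ ps) with extendList xs g ps
  ... | L′ , g′ , L⊆ , all∈ , len with extend g′ (L⊆ p∈L) xp
  ... | extension g″ L′⊆ x∈ len′ =
    _ , g″ , L′⊆ ∘ L⊆ , x∈ ∷ All.map L′⊆ all∈ , ≤-trans len′ (s≤s len)

  grown-root : ∀ {L} → Grown {G} L → ∃[ v ] v ∈ L
  grown-root (root v)           = v , here refl
  grown-root (attach x _ _ _ _) = x , here refl

  spanning : Connected G → ∃[ L ] Grown {G} L × (∀ v → v ∈ L)
  spanning (0<n , conn) with go (allFin (order G))
    where
    go : ∀ xs → ∃[ L ] Grown {G} L × (∀ {v} → v ∈ xs → v ∈ L)
    go []       = _ , root (fromℕ< 0<n) , λ ()
    go (x ∷ xs) with go xs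
    ... | L , g , cover with grown-root g
    ... | u , u∈L with extendWalk g u∈L (conn u x)
    ... | extension g′ L⊆ x∈ _ = _ , g′ , λ { (here refl) → x∈ ; (there v∈) → L⊆ (cover v∈) }
  ... | L , g , cover = L , g , λ v → cover (∈-allFin v)

  -- The time at which `v` joined the tree, the root having time 0; leaves attached later do not
  -- change it. Absent vertices get a junk value.
  rank : List V → V → ℕ
  rank []      v = 0
  rank (x ∷ L) v with v ≟ᶠ x
  ... | yes _ = length L
  ... | no  _ = rank L v

  rank-head : ∀ x L → rank (x ∷ L) x ≡ length L
  rank-head x L with x ≟ᶠ x
  ... | yes _  = refl
  ... | no x≢x = ⊥-elim (x≢x refl)

  rank-tail : ∀ {x v} L → v ≢ x → rank (x ∷ L) v ≡ rank L v
  rank-tail {x} {v} L v≢x with v ≟ᶠ x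
  ... | yes v≡x = ⊥-elim (v≢x v≡x)
  ... | no  _   = refl

  rank< : ∀ {L v} → v ∈ L → rank L v < length L
  rank< {x ∷ L} {v} v∈ with v ≟ᶠ x
  rank< {x ∷ L} {v} v∈           | yes _   = ≤-refl
  rank< {x ∷ L} {v} (here v≡x)   | no  v≢x = ⊥-elim (v≢x v≡x)
  rank< {x ∷ L} {v} (there v∈)   | no  _   = m≤n⇒m≤1+n (rank< v∈)

  -- The hub colouring

  record Hubs (D : List V) : Set where
    field
      hub₀ hub₁ hub₂ : V → V
      hub₀∈ : ∀ {u} → u ∉ D → hub₀ u ∈ D × Adj G u (hub₀ u)
      hub₁∈ : ∀ {u} → u ∉ D → hub₁ u ∈ D × Adj G u (hub₁ u)
      hub₂∈ : ∀ {u} → u ∉ D → hub₂ u ∈ D × Adj G u (hub₂ u)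
      hub₁≢₀ : ∀ {u} → u ∉ D → hub₁ u ≢ hub₀ u
      hub₂≢₀ : ∀ {u} → u ∉ D → hub₂ u ≢ hub₀ u
      hub₂≢₁ : ∀ {u} → u ∉ D → hub₂ u ≢ hub₁ u

  -- An edge inside the grown list D gets the rank of its later endpoint, so the
  -- tree growing D is rainbow; three further colours attach the vertices of S.
  module HubColoring {D : List V} (gD : Grown {G} D) (hubs : Hubs D) where
    open Hubs hubs

    private
      N : ℕ
      N = length D

    hubColor : V → V → ℕ
    hubColor u v with v ≟ᶠ hub₀ u
    ... | yes _ = N
    ... | no  _ with v ≟ᶠ hub₁ u
    ...   | yes _ = 1 + N
    -- Edges from `u` to vertices of `D` that are no hub of `u` share this colour; the trees built
    -- below avoid them.
    ...   | no  _ = 2 + N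

    colorℕ : V → V → ℕ
    colorℕ u v with u ∈? D | v ∈? D
    ... | yes _ | yes _ = rank D u ⊔ rank D v
    ... | no  _ | yes _ = hubColor u v
    ... | yes _ | no  _ = hubColor v u
    -- Edges outside `D` occur in none of the trees, so their colour is arbitrary.
    ... | no  _ | no  _ = 0

    hubColor< : ∀ u v → hubColor u v < 3 + N
    hubColor< u v with v ≟ᶠ hub₀ u
    ... | yes _ = m≤n+m (suc N) 2
    ... | no  _ with v ≟ᶠ hub₁ u
    ...   | yes _ = m≤n+m (2 + N) 1
    ...   | no  _ = ≤-refl

    colorℕ< : ∀ u v → colorℕ u v < 3 + N
    colorℕ< u v with u ∈? D | v ∈? D
    ... | yes p | yes q = ≤-trans (⊔-pres-<m (rank< p) (rank< q)) (m≤n+m N 3)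
    ... | no  _ | yes _ = hubColor< u v
    ... | yes _ | no  _ = hubColor< v u
    ... | no  _ | no  _ = s≤s z≤n

    colorℕ-symm : ∀ u v → colorℕ u v ≡ colorℕ v u
    colorℕ-symm u v with u ∈? D | v ∈? D
    ... | yes _ | yes _ = ⊔-comm (rank D u) (rank D v)
    ... | no  _ | yes _ = refl
    ... | yes _ | no  _ = refl
    ... | no  _ | no  _ = refl

    color-inside : ∀ {u v} → u ∈ D → v ∈ D → colorℕ u v ≡ rank D u ⊔ rank D v
    color-inside {u} {v} p q with u ∈? D | v ∈? D
    ... | yes _ | yes _ = refl
    ... | no ¬p | _     = ⊥-elim (¬p p)
    ... | yes _ | no ¬q = ⊥-elim (¬q q)

    color-hub : ∀ {u v} → u ∉ D → v ∈ D → colorℕ u v ≡ hubColor u v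
    color-hub {u} {v} ¬p q with u ∈? D | v ∈? D
    ... | yes p | _     = ⊥-elim (¬p p)
    ... | no _  | yes _ = refl
    ... | no _  | no ¬q = ⊥-elim (¬q q)

    color-hub₀ : ∀ u → hubColor u (hub₀ u) ≡ N
    color-hub₀ u with hub₀ u ≟ᶠ hub₀ u
    ... | yes _ = refl
    ... | no ¬p = ⊥-elim (¬p refl)

    color-hub₁ : ∀ {u} → u ∉ D → hubColor u (hub₁ u) ≡ 1 + N
    color-hub₁ {u} u∉ with hub₁ u ≟ᶠ hub₀ u
    ... | yes p = ⊥-elim (hub₁≢₀ u∉ p)
    ... | no  _ with hub₁ u ≟ᶠ hub₁ u
    ...   | yes _ = refl
    ...   | no ¬p = ⊥-elim (¬p refl)

    color-hub₂ : ∀ {u} → u ∉ D → hubColor u (hub₂ u) ≡ 2 + N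
    color-hub₂ {u} u∉ with hub₂ u ≟ᶠ hub₀ u
    ... | yes p = ⊥-elim (hub₂≢₀ u∉ p)
    ... | no  _ with hub₂ u ≟ᶠ hub₁ u
    ...   | yes p = ⊥-elim (hub₂≢₁ u∉ p)
    ...   | no  _ = refl

    coloring : EdgeColoring G (3 + N)
    coloring = record
      { color = λ u v → fromℕ< (colorℕ< u v)
      ; symm  = λ u v → toℕ-injective
          (trans (toℕ-fromℕ< (colorℕ< u v)) (trans (colorℕ-symm u v) (sym (toℕ-fromℕ< (colorℕ< v u)))))
      }

    -- Induction over the suffixes of `D`, on which ranks agree with those in `D`: the leaf attached
    -- to `L` gives its edge the colour `length L`, above all earlier colours.
    inside-rainbow : ∀ {L} (g : Grown {G} L) → L ⊆ D → (∀ {v} → v ∈ L → rank D v ≡ rank L v) →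
                     All (_< length L) (edgeColors colorℕ g) × Unique (edgeColors colorℕ g)
    inside-rainbow (root v) _ _ = [] , []
    inside-rainbow (attach {L} x {p} g x∉L p∈L _) ⊆D same
      with inside-rainbow g (⊆D ∘ there)
             (λ v∈ → trans (same (there v∈)) (rank-tail L λ { refl → x∉L v∈ }))
    ... | low , uniq =
      s≤s (≤-reflexive eq) ∷ All.map m≤n⇒m≤1+n low ,
      All.map (λ a<n x≡a → <-irrefl (trans (sym x≡a) eq) a<n) low ∷ uniq
      where
      eq : colorℕ x p ≡ length L
      eq = trans (color-inside (⊆D (here refl)) (⊆D (there p∈L)))
        (trans (cong₂ _⊔_ (trans (same (here refl)) (rank-head x L))
                          (trans (same (there p∈L)) (rank-tail L λ { refl → x∉L p∈L })))
               (m≥n⇒m⊔n≡m (<⇒≤ (rank< p∈L))))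

    -- A rainbow tree containing `D` in which the colour `n` is still free.
    record Partial (n : ℕ) : Set where
      field
        {list}   : List V
        grown    : Grown {G} list
        includes : D ⊆ list
        low      : All (_< n) (edgeColors colorℕ grown)
        distinct : Unique (edgeColors colorℕ grown)

    attachHub : ∀ {n} (t : Partial n) u →
                (u ∉ D → ∃[ h ] h ∈ D × Adj G u h × colorℕ u h ≡ n) →
                Σ (Partial (suc n)) λ t′ → Partial.list t ⊆ Partial.list t′ × u ∈ Partial.list t′
    attachHub {n} t u hub with u ∈? Partial.list t
    ... | yes u∈ = record { Partial t ; low = All.map m≤n⇒m≤1+n (Partial.low t) } , id , u∈
    ... | no  u∉ with hub (u∉ ∘ Partial.includes t)
    ... | h , h∈D , uh , eq = record
      { grown    = attach u grown u∉ (includes h∈D) uh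
      ; includes = there ∘ includes
      ; low      = s≤s (≤-reflexive eq) ∷ All.map m≤n⇒m≤1+n low
      ; distinct = All.map (λ a<n x≡a → <-irrefl (trans (sym x≡a) eq) a<n) low ∷ distinct
      } , there , here refl
      where open Partial t

    start : Partial N
    start = record
      { grown    = gD
      ; includes = id
      ; low      = proj₁ (inside-rainbow gD id λ _ → refl)
      ; distinct = proj₂ (inside-rainbow gD id λ _ → refl)
      }

    coloring-is3Rainbow : Is3Rainbow coloring
    coloring-is3Rainbow S ∣S∣≡3 with threeElements S ∣S∣≡3
    ... | a , b , c , _ , _ , cover
      with attachHub start a (λ u∉ → hub₀ a , proj₁ (hub₀∈ u∉) , proj₂ (hub₀∈ u∉) ,
             trans (color-hub u∉ (proj₁ (hub₀∈ u∉))) (color-hub₀ a))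
    ... | t₁ , _ , a∈₁
      with attachHub t₁ b (λ u∉ → hub₁ b , proj₁ (hub₁∈ u∉) , proj₂ (hub₁∈ u∉) ,
             trans (color-hub u∉ (proj₁ (hub₁∈ u∉))) (color-hub₁ u∉))
    ... | t₂ , t₁⊆ , b∈₂
      with attachHub t₂ c (λ u∉ → hub₂ c , proj₁ (hub₂∈ u∉) , proj₂ (hub₂∈ u∉) ,
             trans (color-hub u∉ (proj₁ (hub₂∈ u∉))) (color-hub₂ u∉))
    ... | t₃ , t₂⊆ , c∈₃ =
      stree grown (inTree ∘ cover) ,
      λ {u} {v} {x} {y} e f eq → tree-rainbow colorℕ colorℕ-symm grown distinct u v x y e f
        (trans (sym (toℕ-fromℕ< (colorℕ< _ _))) (trans (cong toℕ eq) (toℕ-fromℕ< (colorℕ< _ _))))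
      where
      open Partial t₃
      inTree : ∀ {v} → v ∈ a ∷ b ∷ c ∷ [] → v ∈ list
      inTree (here refl)                 = t₂⊆ (t₁⊆ a∈₁)
      inTree (there (here refl))         = t₂⊆ b∈₂
      inTree (there (there (here refl))) = c∈₃

-- Ramsey's theorem

length-filter-split : ∀ {A : Set} {P : A → Set} (P? : U.Decidable P) xs →
  length (filter P? xs) + length (filter (¬? ∘ P?) xs) ≡ length xs
length-filter-split P? []       = refl
length-filter-split P? (x ∷ xs) with P? x
... | yes _ = cong suc (length-filter-split P? xs)
... | no  _ = trans (+-suc _ _) (cong suc (length-filter-split P? xs))

-- `AllPairs` relates earlier entries to later ones only, so `Q` may be asymmetric, such as
-- adjacency of `y` to `m x`.
record Homogeneous {A : Set} (P : A → Set) (Q : Rel A 0ℓ) (n : ℕ) : Set where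
  constructor homogeneous
  field
    {list} : List A
    long   : n ≤ length list
    all    : All P list
    pairs  : AllPairs Q list

ramsey# : ℕ → ℕ → ℕ
ramsey# zero    _       = 0
ramsey# (suc _) zero    = 0
ramsey# (suc a) (suc b) = suc (ramsey# a (suc b) + ramsey# (suc a) b)

-- One Ramsey number for each relation tested in `attached-bound`. The entry supplying the centre of
-- a star accounts for `suc r`; `suc (n * r)` is one more than an independent set attached to `n`
-- vertices can have without a K_{1,r}.
growth# : ℕ → ℕ → ℕ → ℕ
growth# r s n = ramsey# (suc r) (ramsey# (suc r) (ramsey# s (suc (n * r))))

dominating# : ℕ → ℕ → ℕ → ℕ
dominating# r s zero    = 1
dominating# r s (suc t) = growth# r s n + (growth# r s n + n)
  where n = dominating# r s t

-- Three hub colours, two independent sets of at most `n * r` vertices each, and the dominating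
-- list.
rainbow# : ℕ → ℕ → ℕ → ℕ
rainbow# r s ℓ = 3 + (n * r + (n * r + n))
  where n = dominating# r s ℓ

module _ {A : Set} {Q R : Rel A 0ℓ} (R? : Decidable R) where

  private
    Q∧R Q∧¬R : Rel A 0ℓ
    Q∧R  x y = Q x y × R x y
    Q∧¬R x y = Q x y × ¬ R x y

  -- Strengthening `P` by the relation to the first entry `x` makes it possible to prepend `x` to
  -- the list returned by the recursive call.
  ramsey : ∀ {P} a b → Homogeneous P Q (ramsey# a b) → Homogeneous P Q∧R a ⊎ Homogeneous P Q∧¬R b
  ramsey zero    b    _ = inj₁ (homogeneous z≤n [] [])
  ramsey (suc a) zero _ = inj₂ (homogeneous z≤n [] [])
  ramsey {P} (suc a) (suc b) (homogeneous {x ∷ xs} (s≤s long) (px ∷ pxs) (qx ∷ qxs))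
    with ramsey# a (suc b) ≤? length (filter (R? x) xs)
  ... | yes many with ramsey {λ y → P y × Q x y × R x y} a (suc b)
          (homogeneous many
            (All.zip (All.filter⁺ _ pxs , All.zip (All.filter⁺ _ qx , All.all-filter (R? x) xs)))
            (AllPairs.filter⁺ _ qxs))
  ...   | inj₁ (homogeneous l ps qs) = inj₁ (homogeneous (s≤s l) (px ∷ All.map proj₁ ps) (All.map proj₂ ps ∷ qs))
  ...   | inj₂ (homogeneous l ps qs) = inj₂ (homogeneous l (All.map proj₁ ps) qs)
  ramsey {P} (suc a) (suc b) (homogeneous {x ∷ xs} (s≤s long) (px ∷ pxs) (qx ∷ qxs))
      | no few with ramsey {λ y → P y × Q x y × ¬ R x y} (suc a) b
          (homogeneous many
            (All.zip (All.filter⁺ _ pxs , All.zip (All.filter⁺ _ qx , All.all-filter (¬? ∘ R? x) xs)))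
            (AllPairs.filter⁺ _ qxs))
    where
    many : ramsey# (suc a) b ≤ length (filter (¬? ∘ R? x) xs)
    many = +-cancelˡ-≤ (ramsey# a (suc b)) _ _
      (≤-trans long (≤-trans (≤-reflexive (sym (length-filter-split (R? x) xs)))
                             (+-monoˡ-≤ _ (<⇒≤ (≰⇒> few)))))
  ...   | inj₁ (homogeneous l ps qs) = inj₁ (homogeneous l (All.map proj₁ ps) qs)
  ...   | inj₂ (homogeneous l ps qs) = inj₂ (homogeneous (s≤s l) (px ∷ All.map proj₁ ps) (All.map proj₂ ps ∷ qs))

homogeneousFamily : ∀ {A : Set} {P : A → Set} {Q : Rel A 0ℓ} {n} → (∀ {x y} → Q x y → Q y x) →
  Homogeneous P Q n → Σ (Fin n → A) λ f → (∀ i → P (f i)) × (∀ {i j} → i ≢ j → Q (f i) (f j))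
homogeneousFamily s (homogeneous {xs} long ps qs) =
  (λ i → lookup xs (inject≤ i long)) ,
  (λ i → All.lookup ps (∈-lookup (inject≤ i long))) ,
  (λ i≢j → lookup-symmetric s qs (i≢j ∘ inject≤-injective long long _ _))

-- The counterpart of splitting off the head: `R` points forward only, so the common target `z` is
-- an entry preceded by `n` others.
homogeneousLast : ∀ {A : Set} {P : A → Set} {Q R : Rel A 0ℓ} n → Homogeneous P (λ x y → Q x y × R x y) (suc n) →
  ∃[ z ] P z × Homogeneous (λ x → R x z) Q n
homogeneousLast {P = P} {Q} {R} n (homogeneous long ps qs) with go n long ps qs
  where
  go : ∀ n {xs} → suc n ≤ length xs → All P xs → AllPairs (λ x y → Q x y × R x y) xs →
       ∃[ z ] z ∈ xs × P z × ∃[ ys ] ys ⊆ xs × n ≤ length ys × All (λ x → R x z) ys × AllPairs Q ys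
  go zero    {x ∷ xs} _          (p ∷ _) _        = x , here refl , p , [] , (λ ()) , z≤n , [] , []
  go (suc n) {x ∷ xs} (s≤s long) (_ ∷ ps) (q ∷ qs) with go n long ps qs
  ... | z , z∈ , pz , ys , ys⊆ , l , rs , qs′ =
    z , there z∈ , pz , x ∷ ys , (λ { (here refl) → here refl ; (there y∈) → there (ys⊆ y∈) }) , s≤s l ,
    proj₂ (All.lookup q z∈) ∷ rs , All.tabulate (λ y∈ → proj₁ (All.lookup q (ys⊆ y∈))) ∷ qs′
... | z , _ , pz , _ , _ , l , rs , qs′ = z , pz , homogeneous l rs qs′

-- Bounded dominating sets

module _ (G : Graph) where

  private
    V : Set
    V = Vertex G

    adj? : Decidable (Adj G)
    adj? = Graph.adj? G

    symm : ∀ {u v} → Adj G u v → Adj G v u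
    symm = Graph.symm G

    loopless : ∀ {u} → ¬ Adj G u u
    loopless = Graph.irrefl G refl

  open import Data.List.Membership.DecPropositional (_≟ᶠ_ {order G}) using (_∈?_)

  Independent : Rel V 0ℓ
  Independent x y = x ≢ y × ¬ Adj G x y

  independent-symm : ∀ {x y} → Independent x y → Independent y x
  independent-symm (x≢y , ¬xy) = x≢y ∘ sym , ¬xy ∘ symm

  embedStar : ∀ {d r} → Homogeneous (Adj G d) Independent r → star r ⊴ G
  embedStar {d} {r} h with homogeneousFamily independent-symm h
  ... | f , d~f , f-ind = record
    { embed     = embed
    ; injective = λ {u} {v} → injective u v
    ; adjacency = adjacency
    }
    where
    embed : Fin (suc r) → V
    embed zero    = d
    embed (suc i) = f i

    injective : ∀ u v → embed u ≡ embed v → u ≡ v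
    injective zero    zero    _  = refl
    injective zero    (suc j) eq = ⊥-elim (loopless (subst (Adj G d) (sym eq) (d~f j)))
    injective (suc i) zero    eq = ⊥-elim (loopless (subst (Adj G d) eq (d~f i)))
    injective (suc i) (suc j) eq with i ≟ᶠ j
    ... | yes i≡j = cong suc i≡j
    ... | no  i≢j = ⊥-elim (proj₁ (f-ind i≢j) eq)

    nonadjacent : ∀ i j → ¬ Adj G (f i) (f j)
    nonadjacent i j e with i ≟ᶠ j
    ... | yes refl = loopless e
    ... | no  i≢j  = proj₂ (f-ind i≢j) e

    adjacency : ∀ u v → StarAdj u v ⇔ Adj G (embed u) (embed v)
    adjacency zero    zero    = mk⇔ (λ ()) loopless
    adjacency zero    (suc j) = mk⇔ (λ _ → d~f j) _
    adjacency (suc i) zero    = mk⇔ (λ _ → symm (d~f i)) _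
    adjacency (suc i) (suc j) = mk⇔ (λ ()) (nonadjacent i j)

  Hairy : (V → V) → Rel V 0ℓ
  Hairy m x y = Independent x y × ¬ Adj G y (m x) × ¬ Adj G x (m y) × Adj G (m x) (m y)

  -- `Hairy` need not ask for distinct clique vertices: the required adjacencies and nonadjacencies
  -- separate them, as there are no loops.
  embedHairyClique : ∀ {m s} → Homogeneous (λ x → Adj G x (m x)) (Hairy m) s → hairyClique s ⊴ G
  embedHairyClique {m} {s} h
    with homogeneousFamily (λ (i , a , b , c) → independent-symm i , b , a , symm c) h
  ... | f , hair , f-pair = record
    { embed     = embed ∘ splitAt s
    ; injective = λ {u} {v} eq → trans (sym (join-splitAt s s u))
        (trans (cong (join s s) (injective (splitAt s u) (splitAt s v) eq)) (join-splitAt s s v))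
    ; adjacency = λ u v → mk⇔ (forth (splitAt s u) (splitAt s v)) (back (splitAt s u) (splitAt s v))
    }
    where
    embed : Fin s ⊎ Fin s → V
    embed (inj₁ i) = m (f i)
    embed (inj₂ i) = f i

    forth : ∀ u v → HairAdj u v → Adj G (embed u) (embed v)
    forth (inj₁ i) (inj₁ j) i≢j  = proj₂ (proj₂ (proj₂ (f-pair i≢j)))
    forth (inj₁ i) (inj₂ j) refl = symm (hair i)
    forth (inj₂ i) (inj₁ j) refl = hair i

    back : ∀ u v → Adj G (embed u) (embed v) → HairAdj u v
    back (inj₁ i) (inj₁ j) e refl = loopless e
    back (inj₁ i) (inj₂ j) e with i ≟ᶠ j
    ... | yes i≡j = i≡j
    ... | no  i≢j = ⊥-elim (proj₁ (proj₂ (f-pair i≢j)) (symm e))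
    back (inj₂ i) (inj₁ j) e with i ≟ᶠ j
    ... | yes i≡j = i≡j
    ... | no  i≢j = ⊥-elim (proj₁ (proj₂ (proj₂ (f-pair i≢j))) e)
    back (inj₂ i) (inj₂ j) e with i ≟ᶠ j
    ... | yes refl = loopless e
    ... | no  i≢j  = proj₂ (proj₁ (f-pair i≢j)) e

    injective : ∀ u v → embed u ≡ embed v → u ≡ v
    injective (inj₁ i) (inj₁ j) eq with i ≟ᶠ j
    ... | yes i≡j = cong inj₁ i≡j
    ... | no  i≢j = ⊥-elim (loopless (subst (Adj G _) (sym eq) (forth (inj₁ i) (inj₁ j) i≢j)))
    injective (inj₁ i) (inj₂ j) eq =
      ⊥-elim (back (inj₂ i) (inj₂ j) (subst (Adj G (f i)) eq (hair i)))
    injective (inj₂ i) (inj₁ j) eq =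
      ⊥-elim (back (inj₂ j) (inj₂ i) (subst (Adj G (f j)) (sym eq) (hair j)))
    injective (inj₂ i) (inj₂ j) eq with i ≟ᶠ j
    ... | yes i≡j = cong inj₂ i≡j
    ... | no  i≢j = ⊥-elim (proj₁ (proj₁ (f-pair i≢j)) eq)

  -- Greedy choice over all vertices. Maximality is stated in the form in which it is used: `I`
  -- dominates `Q`.
  maximalIndependent : {Q : V → Set} → U.Decidable Q →
    ∃[ I ] All Q I × AllPairs Independent I × (∀ {v} → Q v → v ∈ I ⊎ Any (Adj G v) I)
  maximalIndependent {Q} Q? with go (allFin (order G))
    where
    go : ∀ xs → ∃[ I ] All Q I × AllPairs Independent I × (∀ {v} → v ∈ xs → Q v → v ∈ I ⊎ Any (Adj G v) I)
    go []       = [] , [] , [] , λ ()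
    go (x ∷ xs) with go xs
    ... | I , qI , ind , dom with Q? x | x ∈? I | Any.any? (adj? x) I
    ... | no ¬q | _ | _ = I , qI , ind , λ { (here refl) q → ⊥-elim (¬q q) ; (there v∈) → dom v∈ }
    ... | yes _ | yes x∈I | _ = I , qI , ind , λ { (here refl) _ → inj₁ x∈I ; (there v∈) → dom v∈ }
    ... | yes _ | no _ | yes x~I = I , qI , ind , λ { (here refl) _ → inj₂ x~I ; (there v∈) → dom v∈ }
    ... | yes q | no x∉I | no x≁I =
      x ∷ I , q ∷ qI , All.zip (All.¬Any⇒All¬ I x∉I , All.¬Any⇒All¬ I x≁I) ∷ ind , dom′
      where
      dom′ : ∀ {v} → v ∈ x ∷ xs → Q v → v ∈ x ∷ I ⊎ Any (Adj G v) (x ∷ I)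
      dom′ (here refl) _ = inj₁ (here refl)
      dom′ (there v∈)  q with dom v∈ q
      ... | inj₁ v∈I = inj₁ (there v∈I)
      ... | inj₂ v~I = inj₂ (there v~I)
  ... | I , qI , ind , dom = I , qI , ind , dom (∈-allFin _)

  Dominated : List V → V → Set
  Dominated D v = v ∈ D ⊎ Any (Adj G v) D

  dominated? : ∀ D → U.Decidable (Dominated D)
  dominated? D v = (v ∈? D) ⊎-dec Any.any? (adj? v) D

  any-⊆ : ∀ {P : V → Set} {D D′} → D ⊆ D′ → Any P D → Any P D′
  any-⊆ D⊆ a with find a
  ... | x , x∈ , px = lose (D⊆ x∈) px

  dominated-⊆ : ∀ {D D′ v} → D ⊆ D′ → Dominated D v → Dominated D′ v
  dominated-⊆ D⊆ (inj₁ v∈) = inj₁ (D⊆ v∈)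
  dominated-⊆ D⊆ (inj₂ a)  = inj₂ (any-⊆ D⊆ a)

  -- Each vertex of `D` takes care of its neighbours in the list, of which there are fewer than `r`.
  independent-bound : ∀ {r} → ¬ (star r ⊴ G) → ∀ D {xs} → AllPairs Independent xs →
                      All (λ x → Any (Adj G x) D) xs → length xs ≤ length D * r
  independent-bound ¬star []      {[]}    _ _        = z≤n
  independent-bound ¬star []      {_ ∷ _} _ (() ∷ _)
  independent-bound {r} ¬star (d ∷ D) {xs} ind dom = ≤-trans
    (≤-reflexive (sym (length-filter-split (adj? d) xs)))
    (+-mono-≤ (<⇒≤ (≰⇒> λ long → ¬star (embedStar
                (homogeneous long (All.all-filter (adj? d) xs) (AllPairs.filter⁺ (adj? d) ind)))))
              (independent-bound ¬star D (AllPairs.filter⁺ _ ind)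
                (All.zipWith rest (All.filter⁺ (¬? ∘ adj? d) dom , All.all-filter (¬? ∘ adj? d) xs))))
    where
    rest : ∀ {x} → Any (Adj G x) (d ∷ D) × ¬ Adj G d x → Any (Adj G x) D
    rest (here xd  , ¬dx) = ⊥-elim (¬dx (symm xd))
    rest (there xD , _)   = xD

  module _ {r s : ℕ} (¬star : ¬ (star r ⊴ G)) (¬hairy : ¬ (hairyClique s ⊴ G)) where

    -- An independent set whose vertices x reach D through neighbours m x: a
    -- large homogeneous part is a star around some m x, an independent set
    -- of too many m x, or a hairy clique.
    attached-bound : ∀ {D n} (m : V → V) → length D ≤ n →
      ¬ Homogeneous (λ x → Any (Adj G (m x)) D × Adj G x (m x)) Independent (growth# r s n)
    attached-bound {D} {n} m D≤n h
      with ramsey {R = λ x y → Adj G y (m x)} (λ x y → adj? y (m x)) (suc r) _ h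
    ... | inj₁ (homogeneous {_ ∷ _} (s≤s l) _ (q ∷ qs)) =
      ¬star (embedStar (homogeneous l (All.map (symm ∘ proj₂) q) (AllPairs.map proj₁ qs)))
    ... | inj₂ h₁ with ramsey {R = λ x y → Adj G x (m y)} (λ x y → adj? x (m y)) (suc r) _ h₁
    ... | inj₁ h₂ with homogeneousLast r h₂
    ...   | _ , _ , homogeneous l rs qs = ¬star (embedStar (homogeneous l (All.map symm rs) (AllPairs.map proj₁ qs)))
    attached-bound {D} {n} m D≤n h | inj₂ h₁ | inj₂ h₂
      with ramsey {R = λ x y → Adj G (m x) (m y)} (λ x y → adj? (m x) (m y)) s (suc (n * r)) h₂
    ... | inj₁ (homogeneous l ps qs) = ¬hairy (embedHairyClique {m}
            (homogeneous l (All.map proj₂ ps) (AllPairs.map (λ (((i , a) , b) , c) → i , a , b , c) qs)))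
    -- The vertices `m y` are distinct: if `m x` equalled `m y` for an earlier `x`, then `x` would
    -- be adjacent to `m y`.
    ... | inj₂ (homogeneous {ys} l ps qs) = <⇒≱ l (≤-trans
            (≤-reflexive (sym (length-map m ys)))
            (≤-trans (independent-bound ¬star D
                       (AllPairs.map⁺ (allPairs-mapWith
                         (λ { (_ , xm) _ ((_ , ¬xmy) , ¬mm) → (λ eq → ¬xmy (subst (Adj G _) eq xm)) , ¬mm })
                         ps qs))
                       (All.map⁺ (All.map proj₁ ps)))
                     (*-monoˡ-≤ r D≤n)))

    dominateNext : ∀ {D n} → Grown {G} D → length D ≤ n →
      ∃[ D′ ] Grown {G} D′ × D ⊆ D′ × length D′ ≤ growth# r s n + (growth# r s n + n) ×
              (∀ {u v} → Dominated D u → Adj G u v → Dominated D′ v)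
    dominateNext {D} {n} g D≤n = result
      where
      reaches? : ∀ x → U.Decidable (λ u → Any (Adj G u) D × Adj G x u)
      reaches? x u = Any.any? (adj? u) D ×-dec adj? x u

      m : V → V
      m x with any? (reaches? x)
      ... | yes (u , _) = u
      -- With this default `Reached x` fails, since `x` is not adjacent to itself.
      ... | no  _       = x

      Reached : V → Set
      Reached x = Any (Adj G (m x)) D × Adj G x (m x)

      reached : ∀ {x u} → Any (Adj G u) D → Adj G x u → Reached x
      reached {x} {u} uD xu with any? (reaches? x)
      ... | yes (_ , p) = p
      ... | no  ¬p      = ⊥-elim (¬p (u , uD , xu))

      Q : V → Set
      Q x = ¬ Dominated D x × Reached x

      result : ∃[ D′ ] Grown {G} D′ × D ⊆ D′ × length D′ ≤ growth# r s n + (growth# r s n + n) ×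
                       (∀ {u v} → Dominated D u → Adj G u v → Dominated D′ v)
      result with maximalIndependent {Q} (λ x → ¬? (dominated? D x) ×-dec reaches? x (m x))
      ... | I , qI , ind , dom
        with extendList (map m I) g (All.map⁺ (All.map (λ (_ , mD , _) → find mD) qI))
      ... | D₁ , g₁ , D⊆ , m∈ , len₁
        with extendList I g₁ (All.zipWith (λ { (mx∈ , _ , _ , xm) → _ , mx∈ , xm }) (All.map⁻ m∈ , qI))
      ... | D₂ , g₂ , D₁⊆ , I∈ , len₂ =
        D₂ , g₂ , D₁⊆ ∘ D⊆ , bound , next
        where
        I≤ : length I ≤ growth# r s n
        I≤ = <⇒≤ (≰⇒> λ long → attached-bound m D≤n (homogeneous long (All.map proj₂ qI) ind))

        bound : length D₂ ≤ growth# r s n + (growth# r s n + n)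
        bound = ≤-trans len₂ (+-mono-≤ I≤ (≤-trans len₁
          (+-mono-≤ (≤-trans (≤-reflexive (length-map m I)) I≤) D≤n)))

        next : ∀ {u v} → Dominated D u → Adj G u v → Dominated D₂ v
        next {u} {v} domu uv with dominated? D v
        ... | yes domv = dominated-⊆ (D₁⊆ ∘ D⊆) domv
        ... | no ¬domv with domu
        ...   | inj₁ u∈D = ⊥-elim (¬domv (inj₂ (lose u∈D (symm uv))))
        ...   | inj₂ uD  = dominated-⊆ (All.lookup I∈) (dom (¬domv , reached uD (symm uv)))

  -- Balls, levels and geodesics

  module _ (v₀ : V) where

    Ball : ℕ → V → Set
    Ball zero    v = v₀ ≡ v
    Ball (suc t) v = ∃[ u ] Ball t u × (u ≡ v ⊎ Adj G u v)

    ball? : ∀ t → U.Decidable (Ball t)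
    ball? zero    v = v₀ ≟ᶠ v
    ball? (suc t) v = any? λ u → ball? t u ×-dec ((u ≟ᶠ v) ⊎-dec adj? u v)

    ball-suc : ∀ {t v} → Ball t v → Ball (suc t) v
    ball-suc b = _ , b , inj₁ refl

    Level : ℕ → V → Set
    Level t v = Ball t v × (∀ s → s < t → ¬ Ball s v)

    level-adjacent : ∀ {i j u v} → Level i u → Level j v → Adj G u v → i ≤ suc j
    level-adjacent (_ , far) (near , _) uv = ≮⇒≥ λ j<i → far _ j<i (_ , near , inj₂ (symm uv))

    level-unique : ∀ {i j u} → Level i u → Level j u → i ≡ j
    level-unique (b , far) (b′ , far′) =
      ≤-antisym (≮⇒≥ λ j<i → far _ j<i b′) (≮⇒≥ λ i<j → far′ _ i<j b)

    -- q j lies at distance t − j from v₀.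
    geodesic : ∀ t {w} → Level t w →
      Σ (ℕ → V) λ q → q 0 ≡ w × (∀ i j → i + j ≡ t → Level i (q j)) × (∀ j → j < t → Adj G (q (suc j)) (q j))
    geodesic zero    {w} lw = (λ _ → w) , refl , (λ { zero zero _ → lw }) , λ _ ()
    geodesic (suc t) {w} ((u , bu , inj₁ refl) , far) = ⊥-elim (far t ≤-refl bu)
    geodesic (suc t) {w} lw@((u , bu , inj₂ uw) , far)
      with geodesic t {u} (bu , λ s s<t bs → far (suc s) (s≤s s<t) (u , bs , inj₂ uw))
    ... | q , q0 , lev , adj = q′ , refl , lev′ , adj′
      where
      q′ : ℕ → V
      q′ zero    = w
      q′ (suc j) = q j

      lev′ : ∀ i j → i + j ≡ suc t → Level i (q′ j)
      lev′ i zero    eq = subst (λ k → Level k w) (trans (sym eq) (+-comm i 0)) lw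
      lev′ i (suc j) eq = lev i j (suc-injective (trans (sym (+-suc i j)) eq))

      adj′ : ∀ j → j < suc t → Adj G (q′ (suc j)) (q′ j)
      adj′ zero    _         = subst (λ z → Adj G z w) (sym q0) uw
      adj′ (suc j) (s≤s j<t) = adj j j<t

    -- Vertices on different levels differ, and adjacent ones lie at most one level apart, so the
    -- geodesic is induced; its `ℓ` vertices starting from `w` are taken.
    embedPath : ∀ {ℓ t w} → ℓ ≤ t → Level t w → path ℓ ⊴ G
    embedPath {ℓ} {t} ℓ≤t lw with geodesic t lw
    ... | q , _ , lev , adj = record
      { embed     = q ∘ toℕ
      ; injective = λ {u} {v} eq → toℕ-injective (same (toℕ u) (toℕ v) (low u) (low v) eq)
      ; adjacency = λ u v → mk⇔ (forth u v) (back u v)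
      }
      where
      low : ∀ (u : Fin ℓ) → toℕ u < t
      low u = ≤-trans (toℕ<n u) ℓ≤t

      split : ∀ {j} → j < t → ∃[ i ] i + j ≡ t
      split j<t = _ , m∸n+n≡m (<⇒≤ j<t)

      same : ∀ j k → j < t → k < t → q j ≡ q k → j ≡ k
      same j k j< k< eq with split j< | split k<
      ... | i , ij | i′ , i′k with level-unique (lev i j ij) (subst (Level i′) (sym eq) (lev i′ k i′k))
      ... | refl = +-cancelˡ-≡ i j k (trans ij (sym i′k))

      close : ∀ j k → j < t → k < t → Adj G (q j) (q k) → k ≤ suc j
      close j k j< k< e with split j< | split k<
      ... | i , ij | i′ , i′k = +-cancelˡ-≤ i′ k (suc j) (≤-trans (≤-reflexive (trans i′k (sym ij)))
              (≤-trans (+-monoˡ-≤ j (level-adjacent (lev i j ij) (lev i′ k i′k) e)) (≤-reflexive (sym (+-suc i′ j)))))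

      forth : ∀ u v → Adj (path ℓ) u v → Adj G (q (toℕ u)) (q (toℕ v))
      forth u v (inj₁ eq) = subst (λ k → Adj G (q (toℕ u)) (q k)) eq (symm (adj (toℕ u) (low u)))
      forth u v (inj₂ eq) = subst (λ k → Adj G (q k) (q (toℕ v))) eq (adj (toℕ v) (low v))

      back : ∀ u v → Adj G (q (toℕ u)) (q (toℕ v)) → Adj (path ℓ) u v
      back u v e with <-cmp (toℕ u) (toℕ v)
      ... | tri< u<v _ _ = inj₁ (≤-antisym u<v (close _ _ (low u) (low v) e))
      ... | tri≈ _ u≡v _ = ⊥-elim (loopless (subst (λ k → Adj G (q (toℕ u)) (q k)) (sym u≡v) e))
      ... | tri> _ _ v<u = inj₂ (≤-antisym v<u (close _ _ (low v) (low u) (symm e)))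

    -- The first vertex of a walk outside the ball of radius `ℓ` would lie at distance exactly
    -- `suc ℓ` and provide an induced path.
    ball-exhausts : ∀ ℓ → ¬ (path ℓ ⊴ G) → ∀ {v} → Star (Adj G) v₀ v → Ball ℓ v
    ball-exhausts ℓ ¬path = go (ball-zero ℓ)
      where
      ball-zero : ∀ t → Ball t v₀
      ball-zero zero    = refl
      ball-zero (suc t) = ball-suc {t} (ball-zero t)

      ball-≤ : ∀ {s t} → s ≤ t → ∀ {v} → Ball s v → Ball t v
      ball-≤ {t = zero}  z≤n b = b
      ball-≤ {zero} {suc t} z≤n b = ball-suc {t} (ball-≤ z≤n b)
      ball-≤ (s≤s s≤t) (u , b , e) = u , ball-≤ s≤t b , e

      go : ∀ {u v} → Ball ℓ u → Star (Adj G) u v → Ball ℓ v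
      go b ε = b
      go b (_◅_ {j = w} e walk) with ball? ℓ w
      ... | yes bw = go bw walk
      ... | no ¬bw = ⊥-elim (¬path (embedPath (n≤1+n ℓ)
              ((_ , b , inj₂ e) , λ { s (s≤s s≤ℓ) bs → ¬bw (ball-≤ s≤ℓ bs) })))


  dominated-outside : ∀ {D u} → Dominated D u → u ∉ D → Any (Adj G u) D
  dominated-outside dom u∉ with dom
  ... | inj₁ u∈ = ⊥-elim (u∉ u∈)
  ... | inj₂ a  = a

  boundedDominating : ∀ {r s ℓ} → Connected G → ¬ (star r ⊴ G) → ¬ (hairyClique s ⊴ G) → ¬ (path ℓ ⊴ G) →
    ∃[ D ] Grown {G} D × length D ≤ dominating# r s ℓ × (∀ v → Dominated D v)
  boundedDominating {r} {s} {ℓ} (0<n , conn) ¬star ¬hairy ¬path with go ℓ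
    where
    v₀ : V
    v₀ = fromℕ< 0<n

    go : ∀ t → ∃[ D ] Grown {G} D × length D ≤ dominating# r s t × (∀ {v} → Ball v₀ t v → Dominated D v)
    go zero    = v₀ ∷ [] , root v₀ , ≤-refl , λ { refl → inj₁ (here refl) }
    go (suc t) with go t
    ... | D , g , D≤ , dom with dominateNext ¬star ¬hairy g D≤
    ... | D′ , g′ , D⊆ , D′≤ , next =
      D′ , g′ , D′≤ , λ { (u , b , inj₁ refl) → dominated-⊆ D⊆ (dom b) ; (u , b , inj₂ uv) → next (dom b) uv }
  ... | D , g , D≤ , dom = D , g , D≤ , λ v → dom (ball-exhausts _ ℓ ¬path (conn _ v))

  neighbourIn : List V → V → V
  neighbourIn D u with Any.any? (adj? u) D
  ... | yes a = proj₁ (find a)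
  ... | no  _ = u

  neighbourIn∈ : ∀ {D u} → Any (Adj G u) D → neighbourIn D u ∈ D × Adj G u (neighbourIn D u)
  neighbourIn∈ {D} {u} a with Any.any? (adj? u) D
  ... | yes a′ = proj₂ (find a′)
  ... | no  ¬a = ⊥-elim (¬a a)

  -- Two successive maximal independent sets outside a dominating list D give
  -- every remaining vertex a neighbour in each of them, besides the one in D.
  boundedRainbow : ∀ {r s ℓ} → Connected G → ¬ (star r ⊴ G) → ¬ (hairyClique s ⊴ G) → ¬ (path ℓ ⊴ G) →
    ∃[ k ] k ≤ rainbow# r s ℓ × Σ (EdgeColoring G k) Is3Rainbow
  boundedRainbow {r} {s} {ℓ} conn ¬star ¬hairy ¬path with boundedDominating {r} {s} {ℓ} conn ¬star ¬hairy ¬path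
  ... | D , g , D≤ , dom
    with maximalIndependent {_∉ D} (λ v → ¬? (v ∈? D))
  ... | I₁ , I₁∉ , ind₁ , dom₁
    with extendList I₁ g (All.map (find ∘ dominated-outside (dom _)) I₁∉)
  ... | D₁ , g₁ , D⊆ , I₁⊆ , len₁
    with maximalIndependent {_∉ D₁} (λ v → ¬? (v ∈? D₁))
  ... | I₂ , I₂∉ , ind₂ , dom₂
    with extendList I₂ g₁ (All.map (λ v∉ → find (any-⊆ D⊆ (dominated-outside (dom _) (v∉ ∘ D⊆)))) I₂∉)
  ... | D₂ , g₂ , D₁⊆ , I₂⊆ , len₂ = 3 + length D₂ , s≤s (s≤s (s≤s bound)) , coloring , coloring-is3Rainbow
    where
    n : ℕ
    n = dominating# r s ℓ

    bound : length D₂ ≤ n * r + (n * r + n)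
    -- The vertices of `I₂` have neighbours in the original `D`, so its size is bounded by `n * r`
    -- as well, without reference to the larger `D₁`.
    bound = ≤-trans len₂ (+-mono-≤
      (≤-trans (independent-bound ¬star D ind₂ (All.map (λ v∉ → dominated-outside (dom _) (v∉ ∘ D⊆)) I₂∉))
               (*-monoˡ-≤ r D≤))
      (≤-trans len₁ (+-mono-≤
        (≤-trans (independent-bound ¬star D ind₁ (All.map (dominated-outside (dom _)) I₁∉)) (*-monoˡ-≤ r D≤)) D≤)))

    hub₀∈ : ∀ {u} → u ∉ D₂ → neighbourIn D u ∈ D × Adj G u (neighbourIn D u)
    hub₀∈ u∉ = neighbourIn∈ (dominated-outside (dom _) (u∉ ∘ D₁⊆ ∘ D⊆))

    hub₁∈ : ∀ {u} → u ∉ D₂ → neighbourIn I₁ u ∈ I₁ × Adj G u (neighbourIn I₁ u)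
    hub₁∈ u∉ = neighbourIn∈ (dominated-outside (dom₁ (u∉ ∘ D₁⊆ ∘ D⊆)) (u∉ ∘ D₁⊆ ∘ All.lookup I₁⊆))

    hub₂∈ : ∀ {u} → u ∉ D₂ → neighbourIn I₂ u ∈ I₂ × Adj G u (neighbourIn I₂ u)
    hub₂∈ u∉ = neighbourIn∈ (dominated-outside (dom₂ (u∉ ∘ D₁⊆)) (u∉ ∘ All.lookup I₂⊆))

    hubs : Hubs {G} D₂
    hubs = record
      { hub₀   = neighbourIn D
      ; hub₁   = neighbourIn I₁
      ; hub₂   = neighbourIn I₂
      ; hub₀∈  = λ u∉ → D₁⊆ (D⊆ (proj₁ (hub₀∈ u∉))) , proj₂ (hub₀∈ u∉)
      ; hub₁∈  = λ u∉ → D₁⊆ (All.lookup I₁⊆ (proj₁ (hub₁∈ u∉))) , proj₂ (hub₁∈ u∉)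
      ; hub₂∈  = λ u∉ → All.lookup I₂⊆ (proj₁ (hub₂∈ u∉)) , proj₂ (hub₂∈ u∉)
      -- The hubs lie in the pairwise disjoint lists `D`, `I₁` and `I₂`.
      ; hub₁≢₀ = λ u∉ eq → All.lookup I₁∉ (proj₁ (hub₁∈ u∉)) (subst (_∈ D) (sym eq) (proj₁ (hub₀∈ u∉)))
      ; hub₂≢₀ = λ u∉ eq → All.lookup I₂∉ (proj₁ (hub₂∈ u∉)) (D⊆ (subst (_∈ D) (sym eq) (proj₁ (hub₀∈ u∉))))
      ; hub₂≢₁ = λ u∉ eq → All.lookup I₂∉ (proj₁ (hub₂∈ u∉))
                   (All.lookup I₁⊆ (subst (_∈ I₁) (sym eq) (proj₁ (hub₁∈ u∉))))
      }

    open HubColoring g₂ hubs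

-- Decidability of induced subgraphs

-- Exhaustive search over the maps between finite sets, tabulated as vectors.
anyVec? : ∀ {n m} {P : Vec (Fin n) m → Set} → U.Decidable P → Dec (∃ P)
anyVec? {m = zero}  P? = map′ ([] ,_) (λ { ([] , p) → p }) (P? [])
anyVec? {m = suc m} P? = map′ (λ (x , xs , p) → x ∷ xs , p) (λ { (x ∷ xs , p) → x , xs , p })
  (any? λ x → anyVec? λ xs → P? (x ∷ xs))

Embedding : (H G : Graph) → (Vertex H → Vertex G) → Set
Embedding H G f = ∀ u v → (f u ≡ f v → u ≡ v) × (Adj H u v → Adj G (f u) (f v)) × (Adj G (f u) (f v) → Adj H u v)

embedding? : ∀ H G → U.Decidable (Embedding H G)
embedding? H G f = all? λ u → all? λ v →
  (f u ≟ᶠ f v →-dec u ≟ᶠ v) ×-dec (Graph.adj? H u v →-dec Graph.adj? G (f u) (f v))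
                            ×-dec (Graph.adj? G (f u) (f v) →-dec Graph.adj? H u v)

embedding⇒⊴ : ∀ {H G f} → Embedding H G f → H ⊴ G
embedding⇒⊴ {f = f} e = record
  { embed     = f
  ; injective = λ {u} {v} → proj₁ (e u v)
  ; adjacency = λ u v → let (_ , to , from) = e u v in mk⇔ to from
  }

_⊴?_ : ∀ H G → Dec (H ⊴ G)
H ⊴? G = map′ (λ (xs , e) → embedding⇒⊴ e) back (anyVec? λ xs → embedding? H G (Vec.lookup xs))
  where
  back : H ⊴ G → ∃[ xs ] Embedding H G (Vec.lookup xs)
  back H⊴G = Vec.tabulate embed , λ u v → subst₂
      (λ x y → (x ≡ y → u ≡ v) × (Adj H u v → Adj G x y) × (Adj G x y → Adj H u v))
      (sym (lookup∘tabulate embed u)) (sym (lookup∘tabulate embed v))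
      (injective , Equivalence.to (adjacency u v) , Equivalence.from (adjacency u v))
    where open _⊴_ H⊴G

⊴-trans : ∀ {F H G} → F ⊴ H → H ⊴ G → F ⊴ G
⊴-trans p q = embedding⇒⊴ {f = Q.embed ∘ P.embed} λ u v →
  P.injective ∘ Q.injective ,
  Equivalence.to (Q.adjacency _ _) ∘ Equivalence.to (P.adjacency u v) ,
  Equivalence.from (P.adjacency u v) ∘ Equivalence.from (Q.adjacency _ _)
  where
  module P = _⊴_ p
  module Q = _⊴_ q

≅⇒⊵ : ∀ {H G} → H ≅ G → G ⊴ H
≅⇒⊵ {H} {G} i = embedding⇒⊴ {f = from} λ u v →
  (λ eq → trans (sym (strictlyInverseˡ u)) (trans (cong to eq) (strictlyInverseˡ v))) ,
  (λ e → Equivalence.from (adjacency _ _) (subst₂ (Adj G) (sym (strictlyInverseˡ u)) (sym (strictlyInverseˡ v)) e)) ,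
  (λ e → subst₂ (Adj G) (strictlyInverseˡ u) (strictlyInverseˡ v) (Equivalence.to (adjacency _ _) e))
  where
  open _≅_ i
  open Inverse bijection

≅-refl : ∀ {H} → H ≅ H
≅-refl = record { bijection = mk↔ₛ′ id id (λ _ → refl) (λ _ → refl) ; adjacency = λ _ _ → mk⇔ id id }

injective⇒surjective : ∀ {m n} {f : Fin m → Fin n} → Injective _≡_ _≡_ f → n ≤ m → ∀ y → ∃[ x ] f x ≡ y
injective⇒surjective {m} {suc n} {f} inj n≤m y with any? (λ x → f x ≟ᶠ y)
... | yes hit  = hit
... | no  miss = ⊥-elim (<⇒≱ n≤m (injective⇒≤ {f = λ x → punchOut (λ y≡fx → miss (x , sym y≡fx))}
                   (inj ∘ punchOut-injective {i = y} _ _)))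

-- An injection into a finite set that is no larger is a bijection.
⊴⇒≅ : ∀ {H G} → H ⊴ G → order G ≤ order H → H ≅ G
⊴⇒≅ p G≤H = record
  { bijection = mk↔ₛ′ embed (proj₁ ∘ pre) (proj₂ ∘ pre) (λ x → injective (proj₂ (pre (embed x))))
  ; adjacency = adjacency
  }
  where
  open _⊴_ p
  pre = injective⇒surjective injective G≤H

free-⊑ : ∀ {𝓕′ 𝓕 G} → 𝓕′ ⊑ 𝓕 → Free 𝓕 G → Free 𝓕′ G
free-⊑ []         free = []
free-⊑ {G = G} (H≅𝓕 ∷ sub) free = notIn H≅𝓕 free ∷ free-⊑ sub free
  where
  notIn : ∀ {H 𝓕} → Any (H ≅_) 𝓕 → Free 𝓕 G → ¬ (H ⊴ G)
  notIn (here H≅F) (¬F ∷ _)  H⊴G = ¬F (⊴-trans (≅⇒⊵ H≅F) H⊴G)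
  notIn (there a)  (_ ∷ ¬𝓕) H⊴G = notIn a ¬𝓕 H⊴G

-- Sufficiency

P₃⊴star : path 3 ⊴ star 3
P₃⊴star = embedding⇒⊴
  (toWitness {a? = embedding? (path 3) (star 3) (Vec.lookup (# 1 ∷ # 0 ∷ # 2 ∷ []))} _)

P₃⊴hairy : path 3 ⊴ hairyClique 3
P₃⊴hairy = embedding⇒⊴
  (toWitness {a? = embedding? (path 3) (hairyClique 3) (Vec.lookup (# 3 ∷ # 0 ∷ # 1 ∷ []))} _)

-- Two clique vertices 0, 1 between their pendant vertices 3, 4.
P₄⊴hairy : path 4 ⊴ hairyClique 3
P₄⊴hairy = embedding⇒⊴
  (toWitness {a? = embedding? (path 4) (hairyClique 3) (Vec.lookup (# 3 ∷ # 0 ∷ # 1 ∷ # 4 ∷ []))} _)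

form-excludes : ∀ {𝓕} → Form 𝓕 → ∃[ r ] ∃[ s ] ∃[ ℓ ] ∀ G → Free 𝓕 G →
  ¬ (star r ⊴ G) × ¬ (hairyClique s ⊴ G) × ¬ (path ℓ ⊴ G)
form-excludes form₁ = 3 , 3 , 3 , λ { G (¬P₃ ∷ []) →
  ¬P₃ ∘ ⊴-trans P₃⊴star ,
  ¬P₃ ∘ ⊴-trans P₃⊴hairy , ¬P₃ }
form-excludes (form₂ {r} _) = r , 3 , 4 , λ { G (¬star ∷ ¬P₄ ∷ []) →
  ¬star , ¬P₄ ∘ ⊴-trans P₄⊴hairy , ¬P₄ }
form-excludes (form₃ {r} {ℓ} _ _ (s , _ , Y⊴)) = r , s , ℓ , λ { G (¬star ∷ ¬Y ∷ ¬path ∷ []) →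
  ¬star , ¬Y ∘ ⊴-trans Y⊴ , ¬path }

Rx₃-bound : ∀ {r s ℓ G k} → Connected G → ¬ (star r ⊴ G) → ¬ (hairyClique s ⊴ G) → ¬ (path ℓ ⊴ G) →
            Rx₃ G k → k ≤ rainbow# r s ℓ
Rx₃-bound {r} {s} {ℓ} {G} conn ¬star ¬hairy ¬path (_ , min) =
  let (k′ , k′≤ , c) = boundedRainbow G {r} {s} {ℓ} conn ¬star ¬hairy ¬path
  in ≤-trans (min k′ c) k′≤

sufficiency : ∀ 𝓕 → ContainsForm 𝓕 → Rx₃≤Sdiam₃+Const 𝓕
sufficiency 𝓕 (𝓕′ , sub , form) =
  let (r , s , ℓ , excludes) = form-excludes form
  in rainbow# r s ℓ , λ G conn _ free {k} {d} rx _ →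
     let (¬star , ¬hairy , ¬path) = excludes G (free-⊑ sub free)
     in ≤-trans (Rx₃-bound {r} {s} {ℓ} {G} {k} conn ¬star ¬hairy ¬path rx) (m≤n+m (rainbow# r s ℓ) d)

-- Lower bounds on rx₃ and upper bounds on sdiam₃

-- `P` need not be decidable. If no minimum exists, strong induction refutes `P` everywhere.
minimum-exists : ∀ {ℓ} {P : ℕ → Set ℓ} {n} → P n → ¬ ¬ ∃ (IsMinimum P)
minimum-exists {P = P} {n} p none = <-rec (λ n → ¬ P n)
  (λ n below p → none (n , p , λ k pk → ≮⇒≥ λ k<n → below k<n pk)) n p

-- Induction on the room left between `n` and the bound `B`.
maximum-exists : ∀ {ℓ} {P : ℕ → Set ℓ} {n} → P n → ∀ B → (∀ k → P k → k ≤ B) → ¬ ¬ ∃ (IsMaximum P)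
maximum-exists {P = P} {n} p B bounded none = empty B n (m≤n+m B n) p
  where
  empty : ∀ j n → B ≤ n + j → ¬ P n
  empty zero    n B≤ p = none (n , p , λ k pk → ≤-trans (bounded k pk) (subst (B ≤_) (+-identityʳ n) B≤))
  empty (suc j) n B≤ p = none (n , p , λ k pk → ≮⇒≥ λ n<k →
    empty j k (≤-trans B≤ (≤-trans (≤-reflexive (+-suc n j)) (+-monoˡ-≤ j n<k))) pk)

insert : ∀ {n} (x : Fin n) (S : Subset n) → ¬ (x ∈ˢ S) →
  ∃[ S′ ] ∣ S′ ∣ ≡ suc ∣ S ∣ × x ∈ˢ S′ × (∀ {v} → v ∈ˢ S → v ∈ˢ S′) × (∀ {v} → v ∈ˢ S′ → v ≡ x ⊎ v ∈ˢ S)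
insert zero (inside  ∷ S) x∉ = ⊥-elim (x∉ Vec.here)
insert zero (outside ∷ S) x∉ = inside ∷ S , refl , Vec.here , (λ { (Vec.there v∈) → Vec.there v∈ }) ,
  λ { Vec.here → inj₁ refl ; (Vec.there v∈) → inj₂ (Vec.there v∈) }
insert (suc x) (s ∷ S) x∉ with insert x S (x∉ ∘ Vec.there)
... | S′ , card , x∈ , ⊆S′ , S′⊆ = s ∷ S′ , count s , Vec.there x∈ ,
  (λ { Vec.here → Vec.here ; (Vec.there v∈) → Vec.there (⊆S′ v∈) }) ,
  (λ { Vec.here → inj₂ Vec.here ; (Vec.there v∈) → back (S′⊆ v∈) })
  where
  count : ∀ s → ∣ s ∷ S′ ∣ ≡ suc ∣ s ∷ S ∣
  count inside  = cong suc card
  count outside = card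

  back : ∀ {v} → v ≡ x ⊎ v ∈ˢ S → suc v ≡ suc x ⊎ suc v ∈ˢ s ∷ S
  back (inj₁ refl) = inj₁ refl
  back (inj₂ v∈)   = inj₂ (Vec.there v∈)

fromUnique : ∀ {n} {xs : List (Fin n)} → Unique xs →
  ∃[ S ] ∣ S ∣ ≡ length xs × (∀ {v} → v ∈ xs → v ∈ˢ S) × (∀ {v} → v ∈ˢ S → v ∈ xs)
fromUnique {n} []         = ∅ , ∣⊥∣≡0 n , (λ ()) , ⊥-elim ∘ ∉⊥
fromUnique {xs = x ∷ xs} (x∉ ∷ uniq) with fromUnique uniq
... | S , card , xs⊆ , ⊆xs with insert x S (All.All¬⇒¬Any x∉ ∘ ⊆xs)
... | S′ , card′ , x∈ , ⊆S′ , S′⊆ = S′ , trans card′ (cong suc card) ,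
  (λ { (here refl) → x∈ ; (there v∈) → ⊆S′ (xs⊆ v∈) }) , λ v∈ → back (S′⊆ v∈)
  where
  back : ∀ {v} → v ≡ x ⊎ v ∈ˢ S → v ∈ x ∷ xs
  back (inj₁ refl) = here refl
  back (inj₂ v∈)   = there (⊆xs v∈)

triple : ∀ {n} {a b c : Fin n} → a ≢ b → a ≢ c → b ≢ c →
  ∃[ S ] ∣ S ∣ ≡ 3 × a ∈ˢ S × b ∈ˢ S × c ∈ˢ S
triple a≢b a≢c b≢c with fromUnique ((a≢b ∷ a≢c ∷ []) ∷ (b≢c ∷ []) ∷ [] ∷ [])
... | S , card , ⊆S , _ = S , card , ⊆S (here refl) , ⊆S (there (here refl)) , ⊆S (there (there (here refl)))

someTriple : ∀ {n} → n ≥ 3 → Σ (Subset n) λ S → ∣ S ∣ ≡ 3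
someTriple (s≤s (s≤s (s≤s _))) with triple {a = zero} {suc zero} {suc (suc zero)} (λ ()) (λ ()) (λ ())
... | S , card , _ = S , card

-- For the list of a spanning tree no vertex lies outside, so the hub conditions are vacuous and the
-- hub colouring is a witness.
Rx₃-exists : ∀ {G} → Connected G → ¬ ¬ ∃ (Rx₃ G)
Rx₃-exists {G} conn with spanning conn
... | L , g , all∈ = minimum-exists (coloring , coloring-is3Rainbow)
  where
  hubs : Hubs {G} L
  hubs = record
    { hub₀   = id
    ; hub₁   = id
    ; hub₂   = id
    ; hub₀∈  = λ u∉ → ⊥-elim (u∉ (all∈ _))
    ; hub₁∈  = λ u∉ → ⊥-elim (u∉ (all∈ _))
    ; hub₂∈  = λ u∉ → ⊥-elim (u∉ (all∈ _))
    ; hub₁≢₀ = λ u∉ → ⊥-elim (u∉ (all∈ _))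
    ; hub₂≢₀ = λ u∉ → ⊥-elim (u∉ (all∈ _))
    ; hub₂≢₁ = λ u∉ → ⊥-elim (u∉ (all∈ _))
    }

  open HubColoring g hubs

SteinerBound : Graph → ℕ → Set₁
SteinerBound G B = ∀ S → ∣ S ∣ ≡ 3 → Σ (STree G S) λ t → size (STree.tree t) ≤ B

RainbowBound : Graph → ℕ → Set₁
RainbowBound G N = ∀ {k} (c : EdgeColoring G k) → Is3Rainbow c → N ≤ k

Sdiam₃-exists : ∀ {G B} → order G ≥ 3 → SteinerBound G B → ¬ ¬ (∃ λ d → Sdiam₃ G d × d ≤ B)
Sdiam₃-exists {G} {B} ≥3 steiner none with someTriple ≥3
... | S , card = minimum-exists (proj₁ (steiner S card) , refl) λ (d , isMin) →
      maximum-exists (S , card , isMin) B below λ (m , isMax) → none (m , isMax , below m (proj₁ isMax))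
  where
  below : ∀ d → (Σ (Subset (order G)) λ S → ∣ S ∣ ≡ 3 × SteinerDistance G S d) → d ≤ B
  below d (S , card , _ , min) with steiner S card
  ... | t , t≤B = ≤-trans (min _ (t , refl)) t≤B

-- If no member embeds, `G` is free and N ≤ r ≤ d + C ≤ B + C < N. The goal is then absurdity, so
-- doubly negated existence of `r` and `d` is enough.
forbidden-embeds : ∀ {𝓕 C G B N} →
  (∀ (G : Graph) → Connected G → order G ≥ 3 → Free 𝓕 G → ∀ {r d} → Rx₃ G r → Sdiam₃ G d → r ≤ d + C) →
  Connected G → order G ≥ 3 → SteinerBound G B → RainbowBound G N → B + C < N → Any (_⊴ G) 𝓕
forbidden-embeds {𝓕} {C} {G} bounded conn ≥3 steiner rainbow gap with Any.any? (_⊴? G) 𝓕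
... | yes embeds = embeds
... | no  ¬any   = ⊥-elim (Rx₃-exists conn λ (r , rx) → Sdiam₃-exists ≥3 steiner λ (d , sd , d≤B) →
      n≮n _ (≤-trans gap (≤-trans (rainbow (proj₁ (proj₁ rx)) (proj₂ (proj₁ rx)))
        (≤-trans (bounded G conn ≥3 (All.¬Any⇒All¬ 𝓕 ¬any) rx sd) (+-monoˡ-≤ C d≤B)))))

neighbour : ∀ {A : Set} {R : A → A → Set} {u v} → Star R u v → u ≢ v → ∃[ w ] R u w
neighbour ε       u≢u = ⊥-elim (u≢u refl)
neighbour (e ◅ _) _   = _ , e

-- A tree through a pendant vertex and another vertex uses the pendant edge, so
-- pendant edges receive distinct colours.
pendant-bound : ∀ {G N} (leaf support : Fin N → Vertex G) → Injective _≡_ _≡_ leaf →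
  (∀ i v → Adj G (leaf i) v → v ≡ support i) → (∀ i j → leaf i ≢ support j) → RainbowBound G N
pendant-bound {G} {N} leaf support inj only apart {k} c rainbow = ≮⇒≥ clash
  where
  open EdgeColoring c
  clash : ¬ (k < N)
  clash k<N with pigeonhole k<N (λ i → color (leaf i) (support i))
  -- The support of `i` merely completes the two leaves to a triple.
  ... | i , j , i<j , same with triple (<⇒≢ᶠ i<j ∘ inj) (apart i i) (apart j i)
  ... | S , card , i∈ , j∈ , _ with rainbow S card
  ... | t , rb with STree.covers t i∈ | STree.covers t j∈
  ... | tᵢ , eqᵢ | tⱼ , eqⱼ = contra (rb eᵢ eⱼ (trans (colorOf eᵢ eqᵢ) (trans same (sym (colorOf eⱼ eqⱼ)))))
    where
    open STree t
    tᵢ≢tⱼ : tᵢ ≢ tⱼ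
    tᵢ≢tⱼ eq = <⇒≢ᶠ i<j (inj (trans (sym eqᵢ) (trans (cong embed eq) eqⱼ)))
    wᵢ = proj₁ (neighbour (proj₂ (proj₁ isTree) tᵢ tⱼ) tᵢ≢tⱼ)
    eᵢ = proj₂ (neighbour (proj₂ (proj₁ isTree) tᵢ tⱼ) tᵢ≢tⱼ)
    wⱼ = proj₁ (neighbour (proj₂ (proj₁ isTree) tⱼ tᵢ) (tᵢ≢tⱼ ∘ sym))
    eⱼ = proj₂ (neighbour (proj₂ (proj₁ isTree) tⱼ tᵢ) (tᵢ≢tⱼ ∘ sym))

    supported : ∀ {l u w} → Adj tree u w → embed u ≡ leaf l → embed w ≡ support l
    supported e eq = only _ _ (subst (λ x → Adj G x _) eq (preserves e))

    colorOf : ∀ {l u w} → Adj tree u w → embed u ≡ leaf l → color (embed u) (embed w) ≡ color (leaf l) (support l)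
    colorOf e eq rewrite supported e eq | eq = refl

    contra : ¬ ((tᵢ ≡ tⱼ × wᵢ ≡ wⱼ) ⊎ (tᵢ ≡ wⱼ × wᵢ ≡ tⱼ))
    contra (inj₁ (eq , _)) = tᵢ≢tⱼ eq
    contra (inj₂ (eq , _)) = apart i j (trans (sym eqᵢ) (trans (cong embed eq) (supported eⱼ eqⱼ)))

module _ {G : Graph} (centre : Vertex G) (e : ℕ)
         (walk : ∀ v → Σ (Star (Adj G) centre v) λ w → walkLength w ≤ e) where

  radius-connected : 0 < order G → Connected G
  radius-connected 0<n = 0<n , λ u v → reverse (Graph.symm G) (proj₁ (walk u)) ◅◅ proj₁ (walk v)

  -- The union of three walks from the centre; the 1 is the root, as edges are bounded by vertices.
  radius-steiner : SteinerBound G (e + (e + (e + 1)))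
  radius-steiner S card with threeElements S card
  ... | a , b , c , _ , _ , cover with extendWalk (root centre) (here refl) (proj₁ (walk a))
  ... | extension g₁ ⊆₁ a∈ len₁ with extendWalk g₁ (⊆₁ (here refl)) (proj₁ (walk b))
  ... | extension g₂ ⊆₂ b∈ len₂ with extendWalk g₂ (⊆₂ (⊆₁ (here refl))) (proj₁ (walk c))
  ... | extension {L} g₃ ⊆₃ c∈ len₃ = stree g₃ (inTree ∘ cover) ,
    ≤-trans (tree-size≤ g₃) (≤-trans len₃ (+-mono-≤ (proj₂ (walk c))
      (≤-trans len₂ (+-mono-≤ (proj₂ (walk b)) (≤-trans len₁ (+-monoˡ-≤ 1 (proj₂ (walk a))))))))
    where
    inTree : ∀ {v} → v ∈ a ∷ b ∷ c ∷ [] → v ∈ L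
    inTree (here refl)                 = ⊆₃ (⊆₂ a∈)
    inTree (there (here refl))         = ⊆₃ b∈
    inTree (there (there (here refl))) = c∈

-- Stars and hairy cliques

starWalk : ∀ {n} v → Σ (Star (Adj (star n)) zero v) λ w → walkLength w ≤ 1
starWalk zero    = ε , z≤n
starWalk (suc i) = tt ◅ ε , ≤-refl

star-rainbow : ∀ n → RainbowBound (star n) n
star-rainbow n = pendant-bound suc (λ _ → zero) suc-injectiveᶠ (λ { i zero _ → refl ; i (suc _) () }) (λ _ _ ())

module _ (n : ℕ) where

  private
    s : ℕ
    s = suc n

    K : Graph
    K = hairyClique s

    edge : ∀ x y → HairAdj {s} x y → Adj K (join s s x) (join s s y)
    edge x y = subst₂ HairAdj (sym (splitAt-join s s x)) (sym (splitAt-join s s y))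

  hairyWalk : ∀ v → Σ (Star (Adj K) (zero {n} ↑ˡ s) v) λ w → walkLength w ≤ 2
  hairyWalk v = subst (λ v → Σ (Star (Adj K) (zero {n} ↑ˡ s) v) λ w → walkLength w ≤ 2)
                      (join-splitAt s s v) (go (splitAt s v))
    where
    go : ∀ x → Σ (Star (Adj K) (zero {n} ↑ˡ s) (join s s x)) λ w → walkLength w ≤ 2
    go (inj₁ zero)    = ε , z≤n
    go (inj₁ (suc i)) = edge (inj₁ zero) (inj₁ (suc i)) (λ ()) ◅ ε , n≤1+n 1
    go (inj₂ zero)    = edge (inj₁ zero) (inj₂ zero) refl ◅ ε , n≤1+n 1
    go (inj₂ (suc i)) = edge (inj₁ zero) (inj₁ (suc i)) (λ ()) ◅ edge (inj₁ (suc i)) (inj₂ (suc i)) refl ◅ ε , ≤-refl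

  hairy-rainbow : RainbowBound K s
  hairy-rainbow = pendant-bound (s ↑ʳ_) (_↑ˡ s) (↑ʳ-injective s _ _) only apart
    where
    only : ∀ i v → Adj K (s ↑ʳ i) v → v ≡ i ↑ˡ s
    only i v e with splitAt s v in eq | subst (λ x → HairAdj x (splitAt s v)) (splitAt-↑ʳ s s i) e
    ... | inj₁ j | refl = trans (sym (join-splitAt s s v)) (cong (join s s) eq)
    apart : ∀ i j → s ↑ʳ i ≢ j ↑ˡ s
    apart i j eq with trans (sym (splitAt-↑ʳ s s i)) (trans (cong (splitAt s) eq) (splitAt-↑ˡ s j s))
    ... | ()

starAdj-centre : ∀ {n} {x y : Fin (suc n)} → StarAdj x y → x ≢ zero → y ≡ zero
starAdj-centre {x = zero}              _ x≢0 = ⊥-elim (x≢0 refl)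
starAdj-centre {x = suc _} {y = zero}  _ _   = refl

-- Connectedness yields an edge, and every edge of a star meets the centre, so the centre is in the
-- image. Every other vertex can only have it as a neighbour.
star-subgraph : ∀ {n} H → H ⊴ star n → Connected H → order H ≥ 3 → ∃[ r ] suc r ≡ order H × star r ⊴ H
star-subgraph H@(record { order = suc (suc m) }) H⊴ (_ , conn) _ = suc m , refl , star⊴
  where
  open _⊴_ H⊴
  into : ∀ {u v} → Adj H u v → StarAdj (embed u) (embed v)
  into = Equivalence.to (adjacency _ _)

  findCentre : ∃[ c ] embed c ≡ zero
  findCentre with neighbour (conn zero (suc zero)) (λ ())
  ... | w , e with embed zero ≟ᶠ zero
  ...   | yes eq = zero , eq
  ...   | no neq = w , starAdj-centre (into e) neq

  c : Vertex H
  c = proj₁ findCentre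

  off : ∀ {u} → u ≢ c → embed u ≢ zero
  off u≢c eq = u≢c (injective (trans eq (sym (proj₂ findCentre))))

  leaf : Fin (suc m) → Vertex H
  leaf = punchIn c

  leaf≢ : ∀ i → leaf i ≢ c
  leaf≢ = punchInᵢ≢i c

  spoke : ∀ i → Adj H (leaf i) c
  spoke i with neighbour (conn (leaf i) c) (leaf≢ i)
  ... | w , e = subst (Adj H (leaf i))
    (injective (trans (starAdj-centre (into e) (off (leaf≢ i))) (sym (proj₂ findCentre)))) e

  embed′ : Fin (suc (suc m)) → Vertex H
  embed′ zero    = c
  embed′ (suc i) = leaf i

  star⊴ : star (suc m) ⊴ H
  star⊴ = embedding⇒⊴ {f = embed′} λ
    { zero    zero    → (λ _ → refl) , (λ ()) , Graph.irrefl H refl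
    ; zero    (suc j) → (λ eq → ⊥-elim (leaf≢ j (sym eq))) , (λ _ → Graph.symm H (spoke j)) , _
    ; (suc i) zero    → (λ eq → ⊥-elim (leaf≢ i eq)) , (λ _ → spoke i) , _
    ; (suc i) (suc j) → cong suc ∘ punchIn-injective c i j , (λ ()) ,
        λ e → off (leaf≢ j) (starAdj-centre (into e) (off (leaf≢ i)))
    }
star-subgraph (record { order = suc zero }) _ _ (s≤s ())

-- Cycles

-- Connectedness makes the values of q fill an interval starting at the least one.
interval⇒path : ∀ H → Connected H → (q : Vertex H → ℕ) → Injective _≡_ _≡_ q →
  (∀ {u v} → Adj H u v → suc (q u) ≡ q v ⊎ suc (q v) ≡ q u) →
  (∀ {u v} → suc (q u) ≡ q v → Adj H u v) → path (order H) ≅ H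
interval⇒path (record { order = zero }) (() , _)
interval⇒path H@(record { order = suc m }) (_ , conn) q inj to from = ⊴⇒≅ path⊴ ≤-refl
  where
  h₀ : Vertex H
  h₀ = proj₁ (least q)

  a : ℕ
  a = q h₀

  a≤ : ∀ h → a ≤ q h
  a≤ = proj₂ (least q)

  hit : ∀ (i : Fin (suc m)) → ∃[ h ] q h ≡ a + toℕ i
  hit i with any? (λ h → q h ≟ a + toℕ i)
  ... | yes p   = p
  -- If the value `a + toℕ i` is skipped, connectedness confines `q` to the `toℕ i` values from `a`
  -- up to it, too few for `suc m` vertices.
  ... | no miss = ⊥-elim (<⇒≱ (toℕ<n i) (injective⇒≤ {f = λ h → fromℕ< (offset h)} λ {u} {v} eq →
      inj (∸-cancelʳ-≡ (a≤ u) (a≤ v)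
        (trans (sym (toℕ-fromℕ< (offset u))) (trans (cong toℕ eq) (toℕ-fromℕ< (offset v)))))))
    where
    below : ∀ {u v} → Star (Adj H) u v → q u < a + toℕ i → q v < a + toℕ i
    below ε       lt = lt
    below (e ◅ w) lt with to e
    ... | inj₁ eq = below w (≤∧≢⇒< (subst (_≤ a + toℕ i) eq lt) λ eq′ → miss (_ , eq′))
    ... | inj₂ eq = below w (≤-trans (≤-reflexive eq) (<⇒≤ lt))

    offset : ∀ h → q h ∸ a < toℕ i
    offset h = +-cancelˡ-< a _ _ (subst (_< a + toℕ i) (sym (m+[n∸m]≡n (a≤ h)))
      (below (conn h₀ h) (≤∧≢⇒< (m≤m+n a _) λ eq → miss (h₀ , eq))))

  at : Fin (suc m) → Vertex H
  at = proj₁ ∘ hit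

  path⊴ : path (suc m) ⊴ H
  path⊴ = embedding⇒⊴ {f = at} λ i j →
    (λ eq → toℕ-injective (+-cancelˡ-≡ a _ _ (trans (sym (proj₂ (hit i))) (trans (cong q eq) (proj₂ (hit j)))))) ,
    (λ { (inj₁ eq) → from (forth i j eq) ; (inj₂ eq) → Graph.symm H (from (forth j i eq)) }) ,
    λ e → back i j (to e)
    where
    forth : ∀ i j → suc (toℕ i) ≡ toℕ j → suc (q (at i)) ≡ q (at j)
    forth i j eq = trans (cong suc (proj₂ (hit i)))
      (trans (sym (+-suc a _)) (trans (cong (a +_) eq) (sym (proj₂ (hit j)))))

    unshift : ∀ i j → suc (q (at i)) ≡ q (at j) → suc (toℕ i) ≡ toℕ j
    unshift i j eq = +-cancelˡ-≡ a _ _ (trans (+-suc a _)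
      (trans (cong suc (sym (proj₂ (hit i)))) (trans eq (proj₂ (hit j)))))

    back : ∀ i j → suc (q (at i)) ≡ q (at j) ⊎ suc (q (at j)) ≡ q (at i) → Adj (path (suc m)) i j
    back i j (inj₁ eq) = inj₁ (unshift i j eq)
    back i j (inj₂ eq) = inj₂ (unshift j i eq)

module _ (m : ℕ) where

  private
    n : ℕ
    n = 3 + m

    V : Set
    V = Fin n

  next : V → V
  next u with suc (toℕ u) <? n
  ... | yes p = fromℕ< p
  ... | no  _ = zero

  next-spec : ∀ u → toℕ (next u) ≡ suc (toℕ u) ⊎ (suc (toℕ u) ≡ n × toℕ (next u) ≡ 0)
  next-spec u with suc (toℕ u) <? n
  ... | yes p = inj₁ (toℕ-fromℕ< p)
  ... | no ¬p = inj₂ (≤-antisym (toℕ<n u) (≮⇒≥ ¬p) , refl)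

  next-step : ∀ {u v} → suc (toℕ u) ≡ toℕ v → next u ≡ v
  next-step {u} {v} eq with next-spec u
  ... | inj₁ eq′     = toℕ-injective (trans eq′ eq)
  ... | inj₂ (p , _) = ⊥-elim (<-irrefl (trans (sym eq) p) (toℕ<n v))

  next-wrap : ∀ {u v} → suc (toℕ u) ≡ n → toℕ v ≡ 0 → next u ≡ v
  next-wrap {u} {v} p v≡0 with next-spec u
  ... | inj₁ eq        = ⊥-elim (<-irrefl (trans eq p) (toℕ<n (next u)))
  ... | inj₂ (_ , eq′) = toℕ-injective (trans eq′ (sym v≡0))

  next≢ : ∀ u → next u ≢ u
  next≢ u eq with next-spec u
  ... | inj₁ p       = 1+n≢n (trans (sym p) (cong toℕ eq))
  ... | inj₂ (p , z) with trans (sym p) (cong suc (trans (sym (cong toℕ eq)) z))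
  ...   | ()

  -- Length at least three enters here: only one endpoint of an edge has the other as its successor,
  -- so naming edges by first endpoints is unambiguous.
  next²≢ : ∀ u → next (next u) ≢ u
  next²≢ u eq with next-spec u | next-spec (next u)
  ... | inj₁ p | inj₁ q = m≢1+n+m (toℕ u) {1} (trans (sym (cong toℕ eq)) (trans q (cong suc p)))
  ... | inj₁ p | inj₂ (q , z) with trans (sym q) (cong suc (trans p (cong suc (trans (sym (cong toℕ eq)) z))))
  ...   | ()
  next²≢ u eq | inj₂ (p , z) | inj₁ q
    with trans (sym p) (cong suc (trans (sym (cong toℕ eq)) (trans q (cong suc z))))
  ...   | ()
  next²≢ u eq | inj₂ (p , z) | inj₂ (q , _) with trans (sym q) (cong suc z)
  ...   | ()

  cycle : Graph
  cycle = record
    { order  = n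
    ; Adj    = λ u v → next u ≡ v ⊎ next v ≡ u
    ; adj?   = λ u v → (next u ≟ᶠ v) ⊎-dec (next v ≟ᶠ u)
    ; symm   = swap
    ; irrefl = λ { refl (inj₁ p) → next≢ _ p ; refl (inj₂ p) → next≢ _ p }
    }

  -- The second alternative is a walk that passes once from the last vertex to `zero`.
  forward : ∀ d {x y} → d + toℕ x ≡ toℕ y ⊎ d + toℕ x ≡ n + toℕ y →
            Σ (Star (Adj cycle) x y) λ w → walkLength w ≡ d
  forward zero    (inj₁ eq) with toℕ-injective eq
  ... | refl = ε , refl
  forward zero    {x} (inj₂ eq) = ⊥-elim (<⇒≱ (toℕ<n x) (subst (n ≤_) (sym eq) (m≤m+n n _)))
  forward (suc d) {x} {y} eq with forward d {next x} {y} (shift (next-spec x) eq)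
    where
    shift : toℕ (next x) ≡ suc (toℕ x) ⊎ (suc (toℕ x) ≡ n × toℕ (next x) ≡ 0) →
            suc d + toℕ x ≡ toℕ y ⊎ suc d + toℕ x ≡ n + toℕ y →
            d + toℕ (next x) ≡ toℕ y ⊎ d + toℕ (next x) ≡ n + toℕ y
    shift (inj₁ p) (inj₁ eq) = inj₁ (trans (cong (d +_) p) (trans (+-suc d _) eq))
    shift (inj₁ p) (inj₂ eq) = inj₂ (trans (cong (d +_) p) (trans (+-suc d _) eq))
    shift (inj₂ (p , z)) (inj₁ eq) = ⊥-elim (<⇒≱ (toℕ<n y)
      (subst₂ _≤_ p (trans (+-suc d _) eq) (m≤n+m (suc (toℕ x)) d)))
    shift (inj₂ (p , z)) (inj₂ eq) = inj₁ (trans (cong (d +_) z) (trans (+-identityʳ d)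
      (+-cancelʳ-≡ n d (toℕ y) (trans (cong (d +_) (sym p)) (trans (+-suc d _) (trans eq (+-comm n _)))))))
  ... | w , len = inj₁ refl ◅ w , cong suc len

  cycle-connected : Connected cycle
  cycle-connected = s≤s z≤n , λ u v →
    proj₁ (forward (n + toℕ v ∸ toℕ u) (inj₂ (m∸n+n≡m (≤-trans (<⇒≤ (toℕ<n u)) (m≤m+n n _)))))

  twoArcs : ∀ {S u v w} d₁ d₂ →
    d₁ + toℕ u ≡ toℕ v ⊎ d₁ + toℕ u ≡ n + toℕ v → d₂ + toℕ v ≡ toℕ w ⊎ d₂ + toℕ v ≡ n + toℕ w →
    (∀ {x} → x ∈ˢ S → x ≡ u ⊎ x ≡ v ⊎ x ≡ w) →
    Σ (STree cycle S) λ t → size (STree.tree t) ≤ suc (d₁ + d₂)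
  twoArcs {S} {u} {v} {w} d₁ d₂ e₁ e₂ cover
    with forward d₁ e₁ | forward d₂ e₂
  ... | w₁ , refl | w₂ , refl with extendWalk (root u) (here refl) w₁
  ... | extension g₁ ⊆₁ v∈ len₁ with extendWalk g₁ v∈ w₂
  ... | extension {L} g₂ ⊆₂ w∈ len₂ = stree g₂ (inTree ∘ cover) ,
    ≤-trans (tree-size≤ g₂) (≤-trans len₂ (≤-trans (+-monoʳ-≤ (walkLength w₂) len₁)
      (≤-reflexive (trans (cong (walkLength w₂ +_) (+-comm (walkLength w₁) 1))
        (trans (+-suc _ _) (cong suc (+-comm (walkLength w₂) _)))))))
    where
    inTree : ∀ {x} → x ≡ u ⊎ x ≡ v ⊎ x ≡ w → x ∈ L
    inTree (inj₁ refl)        = ⊆₂ (⊆₁ (here refl))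
    inTree (inj₂ (inj₁ refl)) = ⊆₂ v∈
    inTree (inj₂ (inj₂ refl)) = w∈

  -- Rainbow colourings of a cycle

  module _ {k} (c : EdgeColoring cycle k) (rainbow : Is3Rainbow c) where
    open EdgeColoring c

    edgeColor : V → Fin k
    edgeColor e = color e (next e)

    -- The edges of the cycle (each named by its first endpoint) outside a
    -- rainbow tree through a, b, c lie on a single arc between these vertices.
    record Arcs (a b c : V) : Set₁ where
      field
        Missing : V → Set
        pair    : ∀ {p q} → p ≢ q → edgeColor p ≡ edgeColor q → Missing p ⊎ Missing q
        sep₀₁   : ∀ {e f} → Missing e → Missing f → a Fin.≤ e → e Fin.< b → b Fin.≤ f → f Fin.< c → ⊥
        sep₀₂   : ∀ {e f} → Missing e → Missing f → a Fin.≤ e → e Fin.< b → f Fin.< a ⊎ c Fin.≤ f → ⊥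
        sep₁₂   : ∀ {e f} → Missing e → Missing f → b Fin.≤ e → e Fin.< c → f Fin.< a ⊎ c Fin.≤ f → ⊥

    -- Removing missing edges from two different arcs would cut the cycle into two pieces, each
    -- containing one of a, b, c, and the tree could not connect them.
    arcs : ∀ {a b c} → a Fin.< b → b Fin.< c → Arcs a b c
    arcs {a} {b} {c} a<b b<c
      with triple (<⇒≢ᶠ a<b) (<⇒≢ᶠ (<-trans a<b b<c)) (<⇒≢ᶠ b<c)
    ... | S , card , a∈ , b∈ , c∈ with rainbow S card
    ... | t , rb = record
      { Missing = λ e → ¬ Uses e
      ; pair    = pair
      ; sep₀₁   = λ me mf a≤e e<b b≤f f<c → separate me mf (e<b , b≤f) (inj₁ a≤e) (covers b∈) (covers a∈)
      ; sep₀₂   = λ { me mf a≤e e<b (inj₁ f<a) → separate mf me (f<a , a≤e) (inj₂ e<b) (covers a∈) (covers b∈)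
                    ; me mf a≤e e<b (inj₂ c≤f) →
                        separate me mf (e<b , <⇒≤ (<-≤-trans b<c c≤f)) (inj₁ a≤e) (covers b∈) (covers a∈) }
      ; sep₁₂   = λ { me mf b≤e e<c (inj₁ f<a) →
                        separate mf me (<-trans f<a a<b , b≤e) (inj₂ e<c) (covers b∈) (covers c∈)
                    ; me mf b≤e e<c (inj₂ c≤f) → separate me mf (e<c , c≤f) (inj₁ b≤e) (covers c∈) (covers b∈) }
      }
      where
      open STree t

      Uses : V → Set
      Uses e = ∃₂ λ x y → Adj tree x y × embed x ≡ e × embed y ≡ next e

      uses? : ∀ e → Dec (Uses e)
      uses? e = any? λ x → any? λ y → Graph.adj? tree x y ×-dec (embed x ≟ᶠ e) ×-dec (embed y ≟ᶠ next e)

      pair : ∀ {p q} → p ≢ q → edgeColor p ≡ edgeColor q → ¬ Uses p ⊎ ¬ Uses q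
      pair {p} {q} p≢q same with uses? p | uses? q
      ... | no ¬p | _     = inj₁ ¬p
      ... | yes _ | no ¬q = inj₂ ¬q
      ... | yes (x , y , xy , refl , y≡) | yes (x′ , y′ , xy′ , refl , y′≡)
        with rb xy xy′ (trans (cong (color (embed x)) y≡) (trans same (cong (color (embed x′)) (sym y′≡))))
      ...   | inj₁ (refl , _)    = ⊥-elim (p≢q refl)
      ...   | inj₂ (refl , refl) = ⊥-elim (next²≢ (embed x) (trans (cong next (sym y≡)) (sym y′≡)))

      -- For `e` below `f`, one of the two pieces left when the edges named `e` and `f` are removed.
      Between : V → V → V → Set
      Between e f v = e Fin.< v × v Fin.≤ f

      step : ∀ {e f} → ¬ Uses e → ¬ Uses f → ∀ {x y} → Adj tree x y → Between e f (embed x) → Between e f (embed y)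
      step {e} {f} me mf {x} {y} xy (e<x , x≤f) with preserves xy
      ... | inj₁ nx≡y with next-spec (embed x)
      ...   | inj₁ p = subst (e Fin.<_) nx≡y (subst (toℕ e <_) (sym p) (m<n⇒m<1+n e<x)) ,
                       subst (λ v → toℕ v ≤ toℕ f) nx≡y (subst (_≤ toℕ f) (sym p)
                         (≤∧≢⇒< x≤f λ eq → mf (x , y , xy , toℕ-injective eq ,
                           trans (sym nx≡y) (cong next (toℕ-injective eq)))))
      -- Here `embed x` is the last vertex and at most `f`, hence equal to `f`, so the step would
      -- use the missing edge `f`.
      ...   | inj₂ (p , _) = ⊥-elim (mf (x , y , xy , x≡f , trans (sym nx≡y) (cong next x≡f)))
        where
        x≡f : embed x ≡ f
        x≡f = toℕ-injective (≤-antisym x≤f (s≤s⁻¹ (≤-trans (toℕ<n f) (≤-reflexive (sym p)))))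
      step {e} {f} me mf {x} {y} xy (e<x , x≤f) | inj₂ ny≡x with next-spec (embed y)
      ...   | inj₁ p = ≤∧≢⇒< (s≤s⁻¹ (subst (toℕ e <_) x≡ e<x))
                         (λ eq → me (y , x , Graph.symm tree xy , sym (toℕ-injective eq) ,
                           trans (sym ny≡x) (cong next (sym (toℕ-injective eq))))) ,
                       ≤-trans (n≤1+n _) (subst (_≤ toℕ f) x≡ x≤f)
        where
        x≡ : toℕ (embed x) ≡ suc (toℕ (embed y))
        x≡ = trans (cong toℕ (sym ny≡x)) p
      ...   | inj₂ (_ , z) = ⊥-elim (n≮0 (subst (toℕ e <_) (trans (cong toℕ (sym ny≡x)) z) e<x))

      separate : ∀ {e f} → ¬ Uses e → ¬ Uses f → ∀ {x y} → Between e f x → y Fin.≤ e ⊎ f Fin.< y →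
                 (∃[ s ] embed s ≡ x) → (∃[ s ] embed s ≡ y) → ⊥
      separate {e} {f} me mf btw out (s , refl) (s′ , refl) = contra out (walk (proj₂ (proj₁ isTree) s s′) btw)
        where
        walk : ∀ {x y} → Star (Adj tree) x y → Between e f (embed x) → Between e f (embed y)
        walk ε       b = b
        walk (h ◅ w) b = walk w (step me mf h b)

        contra : embed s′ Fin.≤ e ⊎ f Fin.< embed s′ → ¬ Between e f (embed s′)
        contra (inj₁ y≤e) (e<y , _) = <⇒≱ e<y y≤e
        contra (inj₂ f<y) (_ , y≤f) = <⇒≱ f<y y≤f

    private
      _<ᶠ_ : V → V → Set
      _<ᶠ_ = Fin._<_

      Same : V → V → Set
      Same p q = edgeColor p ≡ edgeColor q

    -- At least two of three equally coloured edges are missing, but i, j, l start the three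
    -- different arcs of the triple i, j, l.
    no-triple : ∀ {i j l} → i <ᶠ j → j <ᶠ l → Same i j → Same j l → ⊥
    no-triple i<j j<l ij jl with arcs i<j j<l
    ... | A with Arcs.pair A (<⇒≢ᶠ i<j) ij
               | Arcs.pair A (<⇒≢ᶠ j<l) jl
               | Arcs.pair A (<⇒≢ᶠ (<-trans i<j j<l)) (trans ij jl)
    ... | inj₁ mi | inj₁ mj | _       = Arcs.sep₀₁ A mi mj ≤-refl i<j ≤-refl j<l
    ... | inj₁ mi | inj₂ ml | _       = Arcs.sep₀₂ A mi ml ≤-refl i<j (inj₂ ≤-refl)
    ... | inj₂ mj | _       | inj₁ mi = Arcs.sep₀₁ A mi mj ≤-refl i<j ≤-refl j<l
    ... | inj₂ mj | _       | inj₂ ml = Arcs.sep₁₂ A mj ml ≤-refl j<l (inj₂ ≤-refl)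

    -- For the triple p, q, j the edges i and j share the arc from j round to p, while p and q lie
    -- on the other two.
    no-nested : ∀ {i p q j} → i <ᶠ p → p <ᶠ q → q <ᶠ j → Same i j → Same p q → ⊥
    no-nested i<p p<q q<j ij pq with arcs p<q q<j
    ... | A with Arcs.pair A (<⇒≢ᶠ p<q) pq | Arcs.pair A (<⇒≢ᶠ (<-trans i<p (<-trans p<q q<j))) ij
    ... | inj₁ mp | inj₁ mi = Arcs.sep₀₂ A mp mi ≤-refl p<q (inj₁ i<p)
    ... | inj₁ mp | inj₂ mj = Arcs.sep₀₂ A mp mj ≤-refl p<q (inj₂ ≤-refl)
    ... | inj₂ mq | inj₁ mi = Arcs.sep₁₂ A mq mi ≤-refl q<j (inj₁ i<p)
    ... | inj₂ mq | inj₂ mj = Arcs.sep₁₂ A mq mj ≤-refl q<j (inj₂ ≤-refl)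

    -- For the triple i, j, p the edges p and q share the arc from p round to i, while i and j lie
    -- on the other two.
    no-parallel : ∀ {i j p q} → i <ᶠ j → j <ᶠ p → p <ᶠ q → Same i j → Same p q → ⊥
    no-parallel i<j j<p p<q ij pq with arcs i<j j<p
    ... | A with Arcs.pair A (<⇒≢ᶠ i<j) ij | Arcs.pair A (<⇒≢ᶠ p<q) pq
    ... | inj₁ mi | inj₁ mp = Arcs.sep₀₂ A mi mp ≤-refl i<j (inj₂ ≤-refl)
    ... | inj₁ mi | inj₂ mq = Arcs.sep₀₂ A mi mq ≤-refl i<j (inj₂ (<⇒≤ p<q))
    ... | inj₂ mj | inj₁ mp = Arcs.sep₁₂ A mj mp ≤-refl j<p (inj₂ ≤-refl)
    ... | inj₂ mj | inj₂ mq = Arcs.sep₁₂ A mj mq ≤-refl j<p (inj₂ (<⇒≤ p<q))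

    -- The arcs of the triple i₁, i₃, j₂ contain the edges i₁, i₂, then i₃, j₁, then j₂, j₃. Each
    -- arc misses one of the three colour pairs, so no single arc can contain an edge of every pair.
    no-crossing : ∀ {i₁ i₂ i₃ j₁ j₂ j₃} → i₁ <ᶠ i₂ → i₂ <ᶠ i₃ → i₃ <ᶠ j₁ → j₁ <ᶠ j₂ → j₂ <ᶠ j₃ →
                  Same i₁ j₁ → Same i₂ j₂ → Same i₃ j₃ → ⊥
    no-crossing i₁<i₂ i₂<i₃ i₃<j₁ j₁<j₂ j₂<j₃ s₁ s₂ s₃
      with arcs (<-trans i₁<i₂ i₂<i₃) (<-trans i₃<j₁ j₁<j₂)
    ... | A with Arcs.pair A (<⇒≢ᶠ (<-trans i₁<i₂ (<-trans i₂<i₃ i₃<j₁))) s₁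
               | Arcs.pair A (<⇒≢ᶠ (<-trans i₂<i₃ (<-trans i₃<j₁ j₁<j₂))) s₂
               | Arcs.pair A (<⇒≢ᶠ (<-trans i₃<j₁ (<-trans j₁<j₂ j₂<j₃))) s₃
    ... | inj₁ x | inj₁ _ | inj₁ z = Arcs.sep₀₁ A x z ≤-refl (<-trans i₁<i₂ i₂<i₃) ≤-refl (<-trans i₃<j₁ j₁<j₂)
    ... | inj₁ x | inj₁ _ | inj₂ z = Arcs.sep₀₂ A x z ≤-refl (<-trans i₁<i₂ i₂<i₃) (inj₂ (<⇒≤ j₂<j₃))
    ... | inj₁ x | inj₂ y | _      = Arcs.sep₀₂ A x y ≤-refl (<-trans i₁<i₂ i₂<i₃) (inj₂ ≤-refl)
    ... | inj₂ x | inj₁ y | _      = Arcs.sep₀₁ A y x (<⇒≤ i₁<i₂) i₂<i₃ (<⇒≤ i₃<j₁) j₁<j₂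
    ... | inj₂ x | inj₂ y | _      = Arcs.sep₁₂ A x y (<⇒≤ i₃<j₁) j₁<j₂ (inj₂ ≤-refl)

    crossing : ∀ {i j i′ j′} → i <ᶠ j → i′ <ᶠ j′ → j <ᶠ j′ → Same i j → Same i′ j′ → i <ᶠ i′ × i′ <ᶠ j
    crossing {i} {j} {i′} {j′} i<j i′<j′ j<j′ ij ij′ with <-cmpᶠ i i′ | <-cmpᶠ i′ j
    ... | tri< i<i′ _ _ | tri< i′<j _ _ = i<i′ , i′<j
    ... | tri< _ _ _    | tri≈ _ refl _ = ⊥-elim (no-triple i<j j<j′ ij ij′)
    ... | tri< _ _ _    | tri> _ _ j<i′ = ⊥-elim (no-parallel i<j j<i′ i′<j′ ij ij′)
    ... | tri≈ _ refl _ | _             = ⊥-elim (no-triple i<j j<j′ ij (trans (sym ij) ij′))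
    ... | tri> _ _ i′<i | _             = ⊥-elim (no-nested i′<i i<j j<j′ ij′ ij)

    Repeat : V → Set
    Repeat j = ∃[ i ] i <ᶠ j × Same i j

    no-three-sorted : ∀ {x y z} → Repeat x → Repeat y → Repeat z → x <ᶠ y → y <ᶠ z → ⊥
    no-three-sorted (i₁ , p₁ , s₁) (i₂ , p₂ , s₂) (i₃ , p₃ , s₃) x<y y<z =
      no-crossing (proj₁ (crossing p₁ p₂ x<y s₁ s₂)) (proj₁ (crossing p₂ p₃ y<z s₂ s₃))
                  (proj₂ (crossing p₁ p₃ (<-trans x<y y<z) s₁ s₃)) x<y y<z s₁ s₂ s₃

    no-three : ∀ {x y z} → Repeat x → Repeat y → Repeat z → x ≢ y → x ≢ z → y ≢ z → ⊥
    no-three {x} {y} {z} rx ry rz x≢y x≢z y≢z with <-cmpᶠ x y | <-cmpᶠ y z | <-cmpᶠ x z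
    ... | tri≈ _ eq _  | _            | _            = x≢y eq
    ... | _            | tri≈ _ eq _  | _            = y≢z eq
    ... | _            | _            | tri≈ _ eq _  = x≢z eq
    ... | tri< x<y _ _ | tri< y<z _ _ | _            = no-three-sorted rx ry rz x<y y<z
    ... | tri< _ _ _   | tri> _ _ z<y | tri< x<z _ _ = no-three-sorted rx rz ry x<z z<y
    ... | tri< x<y _ _ | tri> _ _ _   | tri> _ _ z<x = no-three-sorted rz rx ry z<x x<y
    ... | tri> _ _ y<x | _            | tri< x<z _ _ = no-three-sorted ry rx rz y<x x<z
    ... | tri> _ _ _   | tri< y<z _ _ | tri> _ _ z<x = no-three-sorted ry rz rx y<z z<x
    ... | tri> _ _ y<x | tri> _ _ z<y | tri> _ _ _   = no-three-sorted rz ry rx z<y y<x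

    -- With `m` colours on `3 + m` edges, the pigeonhole principle applies three times, deleting
    -- each repeat found; `punchIn` preserves the order, so three distinct edges repeat an earlier
    -- colour.
    cycle-rainbow : suc m ≤ k
    cycle-rainbow = ≮⇒≥ λ k<1+m → few (s≤s⁻¹ k<1+m)
      where
      punchIn-mono-< : ∀ {l} (i : Fin (suc l)) {x y} → x Fin.< y → punchIn i x Fin.< punchIn i y
      punchIn-mono-< i {x} {y} x<y = ≤∧≢⇒< (punchIn-mono-≤ i x y (<⇒≤ x<y))
        λ eq → <⇒≢ᶠ x<y (punchIn-injective i x y (toℕ-injective eq))

      few : k ≤ m → ⊥
      few k≤m with pigeonhole (s≤s (m≤n⇒m≤1+n (m≤n⇒m≤1+n k≤m))) edgeColor
      ... | i₁ , j₁ , p₁ , s₁ with pigeonhole (s≤s (m≤n⇒m≤1+n k≤m)) (edgeColor ∘ punchIn j₁)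
      ... | i₂ , j₂ , p₂ , s₂ with pigeonhole (s≤s k≤m) (edgeColor ∘ punchIn j₁ ∘ punchIn j₂)
      ... | i₃ , j₃ , p₃ , s₃ = no-three (i₁ , p₁ , s₁) (_ , punchIn-mono-< j₁ p₂ , s₂)
        (_ , punchIn-mono-< j₁ (punchIn-mono-< j₂ p₃) , s₃)
        (punchInᵢ≢i j₁ j₂ ∘ sym) (punchInᵢ≢i j₁ _ ∘ sym)
        (punchInᵢ≢i j₂ j₃ ∘ sym ∘ punchIn-injective j₁ _ _)

  -- Positions along the cycle, counted from the vertex after w.
  module _ (w : V) where

    position : V → ℕ
    position v with toℕ w <? toℕ v
    ... | yes _ = toℕ v ∸ suc (toℕ w)
    ... | no  _ = (toℕ v + n) ∸ suc (toℕ w)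

    -- The two cases of `position` as equations free of truncated subtraction.
    Positioned : V → Set
    Positioned v = (toℕ w < toℕ v × position v + suc (toℕ w) ≡ toℕ v) ⊎
                   (toℕ v < toℕ w × position v + suc (toℕ w) ≡ toℕ v + n)

    position-spec : ∀ {v} → v ≢ w → Positioned v
    position-spec {v} v≢w with toℕ w <? toℕ v
    ... | yes w<v = inj₁ (w<v , m∸n+n≡m w<v)
    ... | no  w≮v = inj₂ (≤∧≢⇒< (≮⇒≥ w≮v) (v≢w ∘ toℕ-injective) ,
                          m∸n+n≡m (≤-trans (toℕ<n w) (m≤n+m n (toℕ v))))

    position-next : ∀ {u v} → u ≢ w → v ≢ w → next u ≡ v → suc (position u) ≡ position v
    position-next {u} {v} u≢w v≢w refl =
      +-cancelʳ-≡ (suc (toℕ w)) _ _ (go (position-spec u≢w) (position-spec v≢w) (next-spec u))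
      where
      go : Positioned u → Positioned v → toℕ v ≡ suc (toℕ u) ⊎ (suc (toℕ u) ≡ n × toℕ v ≡ 0) →
           suc (position u) + suc (toℕ w) ≡ position v + suc (toℕ w)
      go (inj₁ (_ , pu)) (inj₁ (_ , pv)) (inj₁ s) = trans (cong suc pu) (trans (sym s) (sym pv))
      go (inj₁ (w<u , _)) (inj₂ (v<w , _)) (inj₁ s) =
        ⊥-elim (<-asym w<u (≤-trans (≤-trans (n≤1+n _) (≤-reflexive (cong suc (sym s)))) v<w))
      go (inj₂ (u<w , _)) (inj₁ (w<v , _)) (inj₁ s) = ⊥-elim (<⇒≱ w<v (subst (_≤ toℕ w) (sym s) u<w))
      go (inj₂ (_ , pu)) (inj₂ (_ , pv)) (inj₁ s) = trans (cong suc pu) (trans (cong (_+ n) (sym s)) (sym pv))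
      go _ (inj₁ (w<v , _)) (inj₂ (_ , z)) = ⊥-elim (n≮0 (subst (toℕ w <_) z w<v))
      go (inj₁ (_ , pu)) (inj₂ (_ , pv)) (inj₂ (s , z)) =
        trans (cong suc pu) (trans s (trans (cong (_+ n) (sym z)) (sym pv)))
      go (inj₂ (u<w , _)) (inj₂ _) (inj₂ (s , _)) = ⊥-elim (<⇒≱ (toℕ<n w) (subst (_≤ toℕ w) s u<w))

    position-next⁻ : ∀ {u v} → u ≢ w → v ≢ w → suc (position u) ≡ position v → next u ≡ v
    position-next⁻ {u} {v} u≢w v≢w eq with position-spec u≢w | position-spec v≢w
    ... | inj₁ (_ , pu) | inj₁ (_ , pv) = next-step (trans (cong suc (sym pu)) (trans (cong (_+ suc (toℕ w)) eq) pv))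
    ... | inj₂ (_ , pu) | inj₂ (_ , pv) =
      next-step (+-cancelʳ-≡ n _ _ (trans (cong suc (sym pu)) (trans (cong (_+ suc (toℕ w)) eq) pv)))
    ... | inj₁ (_ , pu) | inj₂ (_ , pv) = next-wrap (≤-antisym (toℕ<n u) (subst (n ≤_) (sym total) (m≤n+m n (toℕ v))))
        (n≤0⇒n≡0 (+-cancelʳ-≤ n _ 0 (subst (_≤ n) total (toℕ<n u))))
      where
      total : suc (toℕ u) ≡ toℕ v + n
      total = trans (cong suc (sym pu)) (trans (cong (_+ suc (toℕ w)) eq) pv)
    ... | inj₂ (_ , pu) | inj₁ (_ , pv) = ⊥-elim (<⇒≱ (toℕ<n v)
        (subst (n ≤_) (trans (cong suc (sym pu)) (trans (cong (_+ suc (toℕ w)) eq) pv)) (m≤n+m n (suc (toℕ u)))))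

    position-injective : ∀ {u v} → u ≢ w → v ≢ w → position u ≡ position v → u ≡ v
    position-injective {u} {v} u≢w v≢w eq with position-spec u≢w | position-spec v≢w
    ... | inj₁ (_ , pu) | inj₁ (_ , pv) = toℕ-injective (trans (sym pu) (trans (cong (_+ suc (toℕ w)) eq) pv))
    ... | inj₂ (_ , pu) | inj₂ (_ , pv) =
      toℕ-injective (+-cancelʳ-≡ n _ _ (trans (sym pu) (trans (cong (_+ suc (toℕ w)) eq) pv)))
    ... | inj₁ (_ , pu) | inj₂ (_ , pv) = ⊥-elim (<⇒≱ (toℕ<n u)
        (subst (n ≤_) (sym (trans (sym pu) (trans (cong (_+ suc (toℕ w)) eq) pv))) (m≤n+m n (toℕ v))))
    ... | inj₂ (_ , pu) | inj₁ (_ , pv) = ⊥-elim (<⇒≱ (toℕ<n v)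
        (subst (n ≤_) (trans (sym pu) (trans (cong (_+ suc (toℕ w)) eq) pv)) (m≤n+m n (toℕ u))))

  -- A smaller subgraph misses some vertex `w`; cutting the cycle there makes adjacency a matter of
  -- consecutive positions.
  cycle-subgraph : ∀ H → H ⊴ cycle → Connected H → order H < n → path (order H) ≅ H
  cycle-subgraph H H⊴ conn H<n = interval⇒path H conn (position w ∘ embed)
    (injective ∘ position-injective w (avoid _) (avoid _))
    (λ e → into (Equivalence.to (adjacency _ _) e))
    (λ eq → Equivalence.from (adjacency _ _) (inj₁ (position-next⁻ w (avoid _) (avoid _) eq)))
    where
    open _⊴_ H⊴

    missed : ∃[ w ] ∀ h → embed h ≢ w
    missed with any? (λ w → all? (λ h → ¬? (embed h ≟ᶠ w)))
    ... | yes p = p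
    ... | no ¬p = ⊥-elim (<⇒≱ H<n (injective⇒≤ {f = proj₁ ∘ pre} λ {x} {y} eq →
                    trans (sym (proj₂ (pre x))) (trans (cong embed eq) (proj₂ (pre y)))))
      where
      pre : ∀ w → ∃[ h ] embed h ≡ w
      pre w with any? (λ h → embed h ≟ᶠ w)
      ... | yes hit  = hit
      ... | no  miss = ⊥-elim (¬p (w , λ h eq → miss (h , eq)))

    w : V
    w = proj₁ missed

    avoid : ∀ h → embed h ≢ w
    avoid = proj₂ missed

    into : ∀ {u v} → next (embed u) ≡ embed v ⊎ next (embed v) ≡ embed u →
           suc (position w (embed u)) ≡ position w (embed v) ⊎ suc (position w (embed v)) ≡ position w (embed u)
    into (inj₁ e) = inj₁ (position-next w (avoid _) (avoid _) e)
    into (inj₂ e) = inj₂ (position-next w (avoid _) (avoid _) e)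

-- The longest of the three arcs between the vertices of S is left out.
cycle-steiner : ∀ p → let q = suc p in SteinerBound (cycle (p + (p + p))) (suc (q + q))
cycle-steiner p S card with threeElements S card
... | a , b , c , a<b , b<c , cover = go
  where
  m n q x y z : ℕ
  m = p + (p + p)
  n = 3 + m
  q = suc p
  x = toℕ b ∸ toℕ a
  y = toℕ c ∸ toℕ b
  z = n + toℕ a ∸ toℕ c

  x-eq : x + toℕ a ≡ toℕ b
  x-eq = m∸n+n≡m (<⇒≤ a<b)

  y-eq : y + toℕ b ≡ toℕ c
  y-eq = m∸n+n≡m (<⇒≤ b<c)

  z-eq : z + toℕ c ≡ n + toℕ a
  z-eq = m∸n+n≡m (≤-trans (<⇒≤ (toℕ<n c)) (m≤m+n n _))

  total : x + (y + z) ≡ q + (q + q)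
  total = trans (+-cancelʳ-≡ (toℕ a + (toℕ b + toℕ c)) _ _ (begin
      x + (y + z) + (toℕ a + (toℕ b + toℕ c))         ≡⟨ rearrange x y z (toℕ a) (toℕ b) (toℕ c) ⟩
      (x + toℕ a) + ((y + toℕ b) + (z + toℕ c))       ≡⟨ cong₂ _+_ x-eq (cong₂ _+_ y-eq z-eq) ⟩
      toℕ b + (toℕ c + (n + toℕ a))                   ≡⟨ rotate n (toℕ a) (toℕ b) (toℕ c) ⟩
      n + (toℕ a + (toℕ b + toℕ c))                   ∎)) (thirds p)
    where
    open ≡-Reasoning
    rearrange : ∀ x y z a b c → x + (y + z) + (a + (b + c)) ≡ (x + a) + ((y + b) + (z + c))
    rearrange = solve-∀
    rotate : ∀ n a b c → b + (c + (n + a)) ≡ n + (a + (b + c))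
    rotate = solve-∀
    thirds : ∀ p → 3 + (p + (p + p)) ≡ suc p + (suc p + suc p)
    thirds = solve-∀

  rest≤ : ∀ {s r} → q ≤ s → s + r ≡ q + (q + q) → r ≤ q + q
  rest≤ {s} {r} q≤s eq = +-cancelˡ-≤ q _ _ (≤-trans (+-monoˡ-≤ r q≤s) (≤-reflexive eq))

  shrink : ∀ {d} → d ≤ q + q → Σ (STree (cycle m) S) (λ t → size (STree.tree t) ≤ suc d) →
           Σ (STree (cycle m) S) (λ t → size (STree.tree t) ≤ suc (q + q))
  shrink d≤ (t , t≤) = t , ≤-trans t≤ (s≤s d≤)

  among : ∀ {u v w} → a ≡ u ⊎ a ≡ v ⊎ a ≡ w → b ≡ u ⊎ b ≡ v ⊎ b ≡ w → c ≡ u ⊎ c ≡ v ⊎ c ≡ w →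
          ∀ {t} → t ∈ a ∷ b ∷ c ∷ [] → t ≡ u ⊎ t ≡ v ⊎ t ≡ w
  among a∈ b∈ c∈ (here refl)                 = a∈
  among a∈ b∈ c∈ (there (here refl))         = b∈
  among a∈ b∈ c∈ (there (there (here refl))) = c∈

  go : Σ (STree (cycle m) S) (λ t → size (STree.tree t) ≤ suc (q + q))
  -- Of the 3q edges, dropping an arc of at least q leaves at most 2q; if the first two arcs are
  -- both shorter than q, they suffice.
  go with q ≤? x | q ≤? y
  ... | yes q≤x | _ = shrink (rest≤ q≤x total)
        (twoArcs m y z (inj₁ y-eq) (inj₂ z-eq)
          (among (inj₂ (inj₂ refl)) (inj₁ refl) (inj₂ (inj₁ refl)) ∘ cover))
  ... | no _ | yes q≤y = shrink (rest≤ q≤y (trans (rotate x y z) total))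
        (twoArcs m z x (inj₂ z-eq) (inj₁ x-eq)
          (among (inj₂ (inj₁ refl)) (inj₂ (inj₂ refl)) (inj₁ refl) ∘ cover))
    where
    rotate : ∀ x y z → y + (z + x) ≡ x + (y + z)
    rotate = solve-∀
  ... | no q≰x | no q≰y = shrink (+-mono-≤ (<⇒≤ (≰⇒> q≰x)) (<⇒≤ (≰⇒> q≰y)))
        (twoArcs m x y (inj₁ x-eq) (inj₁ y-eq)
          (among (inj₁ refl) (inj₂ (inj₁ refl)) (inj₂ (inj₂ refl)) ∘ cover))

-- Necessity

P₃⊴star₂ : path 3 ⊴ star 2
P₃⊴star₂ = embedding⇒⊴
  (toWitness {a? = embedding? (path 3) (star 2) (Vec.lookup (# 1 ∷ # 0 ∷ # 2 ∷ []))} _)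

order≤sum : ∀ {H 𝓕} → H ∈ 𝓕 → order H ≤ sum (map order 𝓕)
order≤sum {H} (here refl)        = m≤m+n (order H) _
order≤sum {𝓕 = F ∷ _} (there H∈) = ≤-trans (order≤sum H∈) (m≤n+m _ (order F))

-- The sizes decide the form: two leaves or a path of order 3 give P_3, a path of order 4 gives form
-- (2), and a longer path form (3).
assemble : ∀ {𝓕 S Y P s} → S ∈ 𝓕 → order S ≥ 3 → (∃[ r ] suc r ≡ order S × star r ⊴ S) →
  Y ∈ 𝓕 → s ≥ 3 → Y ⊴ hairyClique s → P ∈ 𝓕 → order P ≥ 3 → path (order P) ≅ P → ContainsForm 𝓕
assemble {𝓕} {S} {Y} {P} S∈ S≥3 (r , eq , star⊴) Y∈ s≥3 Y⊴ P∈ P≥3 path≅ =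
  go r (order P) (s≤s⁻¹ (subst (_≥ 3) (sym eq) S≥3)) P≥3 (≤-reflexive (sym eq)) star⊴ path≅
  where
  go : ∀ r ℓ → r ≥ 2 → ℓ ≥ 3 → order S ≤ suc r → star r ⊴ S → path ℓ ≅ P → ContainsForm 𝓕
  go 1 _ (s≤s ())
  go 2 _ _ _ S≤ star⊴ _ = _ , lose S∈ (⊴⇒≅ (⊴-trans P₃⊴star₂ star⊴) S≤) ∷ [] , form₁
  go (suc (suc (suc _))) 1 _ (s≤s ())
  go (suc (suc (suc _))) 2 _ (s≤s (s≤s ()))
  go (suc (suc (suc _))) 3 _ _ _ _ path≅ = _ , lose P∈ path≅ ∷ [] , form₁
  go (suc (suc (suc _))) 4 _ _ S≤ star⊴ path≅ =
    _ , lose S∈ (⊴⇒≅ star⊴ S≤) ∷ lose P∈ path≅ ∷ [] , form₂ (s≤s (s≤s (s≤s z≤n)))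
  go (suc (suc (suc _))) (suc (suc (suc (suc (suc _))))) _ _ S≤ star⊴ path≅ =
    _ , lose S∈ (⊴⇒≅ star⊴ S≤) ∷ lose Y∈ ≅-refl ∷ lose P∈ path≅ ∷ [] ,
    form₃ (s≤s (s≤s (s≤s z≤n))) (s≤s (s≤s (s≤s (s≤s (s≤s z≤n))))) (_ , s≥3 , Y⊴)

module _ {𝓕 : List Graph} (C : ℕ)
         (bounded : ∀ (G : Graph) → Connected G → order G ≥ 3 → Free 𝓕 G →
                    ∀ {r d} → Rx₃ G r → Sdiam₃ G d → r ≤ d + C) where

  star-embeds : Any (_⊴ star (5 + C)) 𝓕
  -- Radius 1 gives B = 3 + 1, so 5 + C leaves suffice; below, radius 2 gives B = 6 + 1 and 8 + C
  -- hairs.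
  star-embeds = forbidden-embeds {C = C} {G = star (5 + C)} {B = 4} {N = 5 + C} bounded
    (radius-connected {star (5 + C)} zero 1 starWalk (s≤s z≤n)) (s≤s (s≤s (s≤s z≤n)))
    (radius-steiner zero 1 starWalk) (star-rainbow (5 + C)) ≤-refl

  hairy-embeds : Any (_⊴ hairyClique (8 + C)) 𝓕
  hairy-embeds = forbidden-embeds {C = C} {G = hairyClique (8 + C)} {B = 7} {N = 8 + C} bounded
    (radius-connected {hairyClique (8 + C)} zero 2 (hairyWalk (7 + C)) (s≤s z≤n)) (s≤s (s≤s (s≤s z≤n)))
    (radius-steiner zero 2 (hairyWalk (7 + C))) (hairy-rainbow (7 + C)) ≤-refl

  -- Here B = 2p + 3 and N = 3p + 1, so the gap requires p ≥ C + 3; the surplus `M` lengthens the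
  -- cycle at will.
  cycle-embeds : ∀ M → let p = C + 3 + M in Any (_⊴ cycle (p + (p + p))) 𝓕
  cycle-embeds M = forbidden-embeds {C = C} bounded
    (cycle-connected m) (s≤s (s≤s (s≤s z≤n))) (cycle-steiner p) (cycle-rainbow m)
    (≤-trans (m≤m+n _ M) (≤-reflexive (gap C M)))
    where
    p m : ℕ
    p = C + 3 + M
    m = p + (p + p)

    gap : ∀ C M → let p = C + 3 + M in suc (suc (suc p + suc p) + C) + M ≡ suc (p + (p + p))
    gap = solve-∀

necessity : ∀ 𝓕 → All Connected 𝓕 → All (λ H → order H ≥ 3) 𝓕 → Rx₃≤Sdiam₃+Const 𝓕 → ContainsForm 𝓕
necessity 𝓕 conn ≥3 (C , bounded) =
  let (S , S∈ , S⊴) = find (star-embeds C bounded)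
      (Y , Y∈ , Y⊴) = find (hairy-embeds C bounded)
      -- The member `P` depends on the cycle, so `M` must bound the orders of all members in
      -- advance; then `P` is a proper subgraph of the cycle.
      M = sum (map order 𝓕)
      (P , P∈ , P⊴) = find (cycle-embeds C bounded M)
  in assemble S∈ (All.lookup ≥3 S∈) (star-subgraph S S⊴ (All.lookup conn S∈) (All.lookup ≥3 S∈))
       Y∈ (s≤s (s≤s (s≤s z≤n))) Y⊴
       P∈ (All.lookup ≥3 P∈) (cycle-subgraph _ P P⊴ (All.lookup conn P∈)
         (s≤s (≤-trans (order≤sum P∈) (≤-trans (m≤n+m M (C + 3)) (≤-trans (m≤m+n _ _) (m≤n+m _ 2))))))

-- Necessity concerns members of order at least 3: the family consisting of K_2 leaves no free
-- connected graph of order at least 3, so the bound holds vacuously, yet it contains none of the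
-- forms.
theorem10 : ∀ (𝓕 : List Graph) → All Connected 𝓕 →
    (ContainsForm 𝓕 → Rx₃≤Sdiam₃+Const 𝓕)
    × (All (λ H → order H ≥ 3) 𝓕 → Rx₃≤Sdiam₃+Const 𝓕 → ContainsForm 𝓕)
theorem10 𝓕 conn = sufficiency 𝓕 , necessity 𝓕 conn
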